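{- For integers $\nu\ge1$ and $n>\nu(2\nu+3)$, \[ (-1)^\nu\left(\sum_{\tau=0}^{\nu}(-1)^\tau p\big(2n-\tau(2\tau+1)\big)-\sum_{\tau=0}^{\nu-1}(-1)^\tau p\big(2n-(\tau+1)(2\tau+1)\big)\right)=(-1)^\nu p_o(n)+p(3,4,\nu;2n)+p(1,4,\nu;2n) \] and \[ (-1)^\nu\left(\sum_{\tau=0}^{\nu}(-1)^\tau p\big(2n+1-\tau(2\tau+1)\big)-\sum_{\tau=0}^{\nu-1}(-1)^\tau p\big(2n+1-(\tau+1)(2\tau+1)\big)\right)=p(3,4,\nu;2n+1)+p(1,4,\nu;2n+1). \]
   Context: $p(n)$ is the number of partitions of $n$ and $p_o(n)$ the number of partitions of $n$ into odd parts. Definition of $M(a,m,\nu;n)$ (integers $\nu\ge0$, $1\le a<m$, $n\ge0$): for a partition $\lambda_1\ge\dots\ge\lambda_k$ of $n$ into parts $\equiv a\pmod m$, put $\ell_i=(\lambda_i-a)/m+1$ (number of boxes of the row of $\lambda_i$ in the $m$-modular Young diagram), and let $t$ be the largest integer $0\le t\le k$ with $\ell_t\ge t+\nu+2$ (height of the $(\nu+2)$-Durfee rectangle, of width $t+\nu+2$). $M(a,m,\nu;n)$ counts partitions of $n$ into parts $\equiv a\pmod m$ in which each of $a,a+m,\dots,a+m\nu$ occurs at least once and $\ell_i<t+\nu+2$ for all $i>t$. Definition: $p(a,m,\nu;n)$ is the number of partitions of $n$ such that, if $\beta$ is the sum of the parts $\not\equiv a\pmod m$, the parts $\equiv a\pmod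 m$ form a partition counted by $M(a,m,\nu;n-\beta)$. -}

module Defs where

open import Data.Nat using (ℕ; zero; suc; _+_; _*_; _∸_; _⊔_; _≤?_; _<?_; _≟_; NonZero)
open import Data.Nat.DivMod using (_/_; _%_)
open import Data.Bool using (Bool; true; false; _∧_; not)
open import Data.List using (List; []; _∷_; [_]; map; concatMap; length; filter; foldr; zip; upTo)
open import Data.Bool.ListAction using (all; any)
open import Data.Product using (_×_; _,_; proj₁; proj₂)
open import Data.Integer using (ℤ) renaming (_+_ to _+ℤ_)
open import Relation.Nullary.Decidable using (⌊_⌋)

-- Partitions of n, represented as non-increasing lists of positive parts.

-- partsUpTo fuel n m : all partitions of n into parts ≤ m (largest part
-- first).  Each recursive step removes a part ≥ 1, so fuel n suffices.
partsUpTo : ℕ → ℕ → ℕ → List (List ℕ)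
partsUpTo _ zero _ = [ [] ]
partsUpTo zero (suc _) _ = []
partsUpTo (suc f) (suc n) m =
  concatMap (λ j → map (j ∷_) (partsUpTo f (suc n ∸ j) j))
            (filter (λ j → j ≤? m) (map suc (upTo (suc n))))

partitions : ℕ → List (List ℕ)
partitions n = partsUpTo n n n

count : (List ℕ → Bool) → ℕ → ℕ
count P n = length (filter (λ λ′ → P λ′ Data.Bool.≟ true) (partitions n))

p : ℕ → ℕ
p n = length (partitions n)

isOdd : ℕ → Bool
isOdd x = ⌊ x % 2 ≟ 1 ⌋

pₒ : ℕ → ℕ
pₒ = count (all isOdd)

module _ (a m : ℕ) .{{_ : NonZero m}} where

  congA : ℕ → Bool
  congA x = ⌊ x % m ≟ a % m ⌋

  -- ℓ = (λ - a)/m + 1 : number of boxes in the m-modular diagram row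
  ell : ℕ → ℕ
  ell x = suc ((x ∸ a) / m)

  rows : List ℕ → List (ℕ × ℕ)
  rows μ = zip (map suc (upTo (length μ))) (map ell μ)

  durfeeHeight : ℕ → List ℕ → ℕ
  durfeeHeight ν μ =
    foldr _⊔_ 0 (map proj₁
      (filter (λ r → proj₁ r + ν + 2 ≤? proj₂ r) (rows μ)))

  -- μ (a partition into parts ≡ a mod m, non-increasing) is counted by M(a,m,ν;·):
  -- each of a, a+m, …, a+mν occurs, and ℓ_i < t+ν+2 for all i > t.
  isM : ℕ → List ℕ → Bool
  isM ν μ =
    all (λ j → any (λ x → ⌊ x ≟ a + m * j ⌋) μ) (upTo (suc ν))
    ∧ all (λ r → not ⌊ durfeeHeight ν μ <? proj₁ r ⌋
                 Data.Bool.∨ ⌊ proj₂ r <? durfeeHeight ν μ + ν + 2 ⌋) (rows μ)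

  pM : ℕ → ℕ → ℕ
  pM ν = count (λ λ′ → isM ν (filter (λ x → congA x Data.Bool.≟ true) λ′))

sumBelow : ℕ → (ℕ → ℤ) → ℤ
sumBelow N f = foldr _+ℤ_ (ℤ.pos 0) (map f (upTo N))

{-# OPTIONS --safe #-}

-- Write w_j = a + m j.  Processing the parts w_j from the largest to the smallest, the partitions
-- counted by M(a,m,ν;·) are those for which, at some level, the number of larger parts is exactly
-- the height of the Durfee rectangle.  The generating function of the ways to continue from a
-- given state obeys a linear recursion; the recursions for ν and ν + 1 become the same after
-- shifting every large part by m, and their sum is solved by the unrestricted generating function.
-- Hence p(a,m,ν;n) + p(a,m,ν+1;n) = p(n - w_0 - … - w_ν).  For (a,m) = (1,4) and (3,4) these
-- recurrences show that the identity for ν does not depend on ν, and for large ν it becomes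
-- Σ (-1)^τ q^{τ(2τ+1)} / (q;q)_∞ = 1 / (q²;q⁴)_∞, which is Gauss's theorem on triangular numbers.
-- The latter follows from Shanks' finite identity, whose proof is a telescoping sum.
module Submission where

open import Defs
open import Data.Nat using (ℕ; suc; _+_; _*_; _∸_; _<_; _≤_)
open import Data.Integer using (ℤ; +_; -_; -1ℤ; _^_) renaming (_+_ to _+ℤ_; _-_ to _-ℤ_; _*_ to _*ℤ_)
open import Data.Product using (_×_)
open import Relation.Binary.PropositionalEquality using (_≡_)

open import Algebra.Bundles using (CommutativeRing)
import Algebra.Solver.Ring as RingSolver
open import Algebra.Solver.Ring.AlmostCommutativeRing using (AlmostCommutativeRing; fromCommutativeRing; _-Raw-AlmostCommutative⟶_)
open import Algebra.Structures using (IsCommutativeRing)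
open import Data.Bool as Bool using (Bool; true; false; _∧_; _∨_; not; if_then_else_)
open import Data.Bool.ListAction using (all; any)
open import Data.Bool.Properties using (∧-assoc; ∧-zeroʳ; ∧-identityʳ; ∨-assoc)
open import Data.Integer as ℤ using (0ℤ; 1ℤ)
import Data.Integer.Properties as ℤₚ
import Data.Integer.Tactic.RingSolver as ℤSolver
open import Data.List using (List; []; _∷_; [_]; map; concatMap; length; filter; upTo; applyUpTo; zip; foldr; _++_)
import Data.List.Properties as Listₚ
open import Data.List.Relation.Unary.All as All using (All; []; _∷_)
import Data.List.Relation.Unary.All.Properties as Allₚ
open import Data.Maybe using (Maybe; just; nothing)
open import Data.Nat as ℕ using (zero; z≤n; s≤s; _⊔_; _≤?_; _<?_; _≟_)
open import Data.Nat.DivMod using (_/_; _%_; m≡m%n+[m/n]*n; [m+kn]%n≡m%n; m<n*o⇒m/o<n; m*n/n≡m)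
open import Data.Nat.Divisibility using (divides; ∣m+n∣m⇒∣n; ∣⇒≤)
open import Data.Nat.Induction using (<-rec)
import Data.Nat.Properties as ℕₚ
open import Data.Nat.Tactic.RingSolver using (solve-∀)
open import Data.Product using (_,_; ∃; proj₁; proj₂)
open import Data.Sum using (inj₁; inj₂)
open import Function using (_∘_)
open import Level using (0ℓ)
open import Relation.Binary using (IsEquivalence)
open import Relation.Binary.PropositionalEquality using (_≢_; refl; sym; trans; cong; cong₂; subst; module ≡-Reasoning)
import Relation.Binary.Reasoning.Setoid as SetoidReasoning
open import Relation.Nullary using (yes; no; ¬_)
open import Relation.Nullary.Decidable using (Dec; ⌊_⌋; isYes≗does; dec-true; dec-false)

-- Triangular numbers enter from two sides. The parts 3, 7, ... and 1, 5, ... have the partial sums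
-- τ(2τ+1) and (τ+1)(2τ+1), the triangular numbers of even and of odd index, so a recurrence in ν
-- replaces each term of the two alternating sums by two consecutive counts. In Gauss's theorem the
-- same exponents receive the signs (-1)^τ and (-1)^(τ+1) once q is replaced by -q. After division
-- by (q;q)_∞ the product side is a series in q²: this is why p_o(n) appears at 2n and nothing at
-- 2n+1. No limit of series is taken. Infinite products give way to finite ones that agree with them
-- up to the coefficient in question, and series that obey a recursion f = f₀ + q^(k+1) f₁ are
-- compared by induction on the index of the coefficient. Nor is there any division: inverses occur
-- only as equations "finite product times counting series = 1".

-- The ring of formal power series over ℤ

Series : Set
Series = ℕ → ℤ

infix 4 _≈_
record _≈_ (f g : Series) : Set where
  constructor coeffs
  field coeff : ∀ n → f n ≡ g n
open _≈_

infixl 6 _⊕_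
infixl 7 _⊛_
infix 8 ⊖_

const : ℤ → Series
const z zero    = z
const z (suc n) = 0ℤ

𝟘 𝟙 : Series
𝟘 = const 0ℤ
𝟙 = const 1ℤ

𝟘-coeff : ∀ n → 𝟘 n ≡ 0ℤ
𝟘-coeff zero    = refl
𝟘-coeff (suc n) = refl

-- Opaque, so that unification treats these operations as injective.
opaque

  _⊕_ : Series → Series → Series
  (f ⊕ g) n = f n +ℤ g n

  ⊖_ : Series → Series
  (⊖ f) n = - f n

  _⊛_ : Series → Series → Series
  (f ⊛ g) zero    = f 0 *ℤ g 0
  (f ⊛ g) (suc n) = f 0 *ℤ g (suc n) +ℤ ((f ∘ suc) ⊛ g) n

  ⊕-coeff : ∀ f g n → (f ⊕ g) n ≡ f n +ℤ g n
  ⊕-coeff f g n = refl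

  ⊛-zero-coeff : ∀ f g → (f ⊛ g) 0 ≡ f 0 *ℤ g 0
  ⊛-zero-coeff f g = refl

  ⊛-suc-coeff : ∀ f g n → (f ⊛ g) (suc n) ≡ f 0 *ℤ g (suc n) +ℤ ((f ∘ suc) ⊛ g) n
  ⊛-suc-coeff f g n = refl

  ⊛-cong-≤ : ∀ {f f′ g g′} n → (∀ i → i ≤ n → f i ≡ f′ i) → (∀ i → i ≤ n → g i ≡ g′ i) →
             (f ⊛ g) n ≡ (f′ ⊛ g′) n
  ⊛-cong-≤ zero    p q = cong₂ _*ℤ_ (p 0 z≤n) (q 0 z≤n)
  ⊛-cong-≤ (suc n) p q = cong₂ _+ℤ_ (cong₂ _*ℤ_ (p 0 z≤n) (q (suc n) ℕₚ.≤-refl))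
    (⊛-cong-≤ n (λ i i≤n → p (suc i) (s≤s i≤n)) (λ i i≤n → q i (ℕₚ.m≤n⇒m≤1+n i≤n)))

  ⊛-congₙ : ∀ {f f′ g g′} → (∀ i → f i ≡ f′ i) → (∀ i → g i ≡ g′ i) → ∀ n → (f ⊛ g) n ≡ (f′ ⊛ g′) n
  ⊛-congₙ p q n = ⊛-cong-≤ n (λ i _ → p i) (λ i _ → q i)

  ⊛-distribʳₙ : ∀ f g h n → ((f ⊕ g) ⊛ h) n ≡ (f ⊛ h) n +ℤ (g ⊛ h) n
  ⊛-distribʳₙ f g h zero    = ℤₚ.*-distribʳ-+ (h 0) (f 0) (g 0)
  ⊛-distribʳₙ f g h (suc n) = trans (cong ((f 0 +ℤ g 0) *ℤ h (suc n) +ℤ_) (⊛-distribʳₙ (f ∘ suc) (g ∘ suc) h n))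
    (regroup (f 0) (g 0) (h (suc n)) (((f ∘ suc) ⊛ h) n) (((g ∘ suc) ⊛ h) n))
    where
    regroup : ∀ a b c x y → (a +ℤ b) *ℤ c +ℤ (x +ℤ y) ≡ (a *ℤ c +ℤ x) +ℤ (b *ℤ c +ℤ y)
    regroup = ℤSolver.solve-∀

  ⊛-scaleₙ : ∀ a f h n → ((λ i → a *ℤ f i) ⊛ h) n ≡ a *ℤ (f ⊛ h) n
  ⊛-scaleₙ a f h zero    = ℤₚ.*-assoc a (f 0) (h 0)
  ⊛-scaleₙ a f h (suc n) = trans (cong (a *ℤ f 0 *ℤ h (suc n) +ℤ_) (⊛-scaleₙ a (f ∘ suc) h n))
    (regroup a (f 0) (h (suc n)) (((f ∘ suc) ⊛ h) n))
    where
    regroup : ∀ a b c x → a *ℤ b *ℤ c +ℤ a *ℤ x ≡ a *ℤ (b *ℤ c +ℤ x)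
    regroup = ℤSolver.solve-∀

  -- The product recurses on its left factor only; peeling a coefficient off the right factor as
  -- well is what makes commutativity an induction.
  ⊛-unfoldʳ : ∀ f g n → (f ⊛ g) (suc n) ≡ f (suc n) *ℤ g 0 +ℤ (f ⊛ (g ∘ suc)) n
  ⊛-unfoldʳ f g zero    = ℤₚ.+-comm (f 0 *ℤ g 1) (f 1 *ℤ g 0)
  ⊛-unfoldʳ f g (suc n) = trans (cong (f 0 *ℤ g (suc (suc n)) +ℤ_) (⊛-unfoldʳ (f ∘ suc) g n)) 
    (regroup (f 0 *ℤ g (suc (suc n))) (f (suc (suc n)) *ℤ g 0) (((f ∘ suc) ⊛ (g ∘ suc)) n))
    where
    regroup : ∀ a b c → a +ℤ (b +ℤ c) ≡ b +ℤ (a +ℤ c)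
    regroup = ℤSolver.solve-∀

  ⊛-commₙ : ∀ f g n → (f ⊛ g) n ≡ (g ⊛ f) n
  ⊛-commₙ f g zero    = ℤₚ.*-comm (f 0) (g 0)
  ⊛-commₙ f g (suc n) = trans (cong₂ _+ℤ_ (ℤₚ.*-comm (f 0) (g (suc n))) (⊛-commₙ (f ∘ suc) g n))
    (sym (⊛-unfoldʳ g f n))

  ⊛-assocₙ : ∀ f g h n → ((f ⊛ g) ⊛ h) n ≡ (f ⊛ (g ⊛ h)) n
  ⊛-assocₙ f g h zero    = ℤₚ.*-assoc (f 0) (g 0) (h 0)
  ⊛-assocₙ f g h (suc n) = begin
    -- By definition the tail of `f ⊛ g` is a multiple of the tail of `g` plus `(f ∘ suc) ⊛ g`, so
    -- distributivity and scaling apply.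
    f 0 *ℤ g 0 *ℤ h (suc n) +ℤ (((λ i → f 0 *ℤ g (suc i)) ⊕ ((f ∘ suc) ⊛ g)) ⊛ h) n
      ≡⟨ cong (f 0 *ℤ g 0 *ℤ h (suc n) +ℤ_) (⊛-distribʳₙ (λ i → f 0 *ℤ g (suc i)) ((f ∘ suc) ⊛ g) h n) ⟩
    f 0 *ℤ g 0 *ℤ h (suc n) +ℤ (((λ i → f 0 *ℤ g (suc i)) ⊛ h) n +ℤ (((f ∘ suc) ⊛ g) ⊛ h) n)
      ≡⟨ cong (f 0 *ℤ g 0 *ℤ h (suc n) +ℤ_) (cong₂ _+ℤ_ (⊛-scaleₙ (f 0) (g ∘ suc) h n) (⊛-assocₙ (f ∘ suc) g h n)) ⟩
    f 0 *ℤ g 0 *ℤ h (suc n) +ℤ (f 0 *ℤ ((g ∘ suc) ⊛ h) n +ℤ ((f ∘ suc) ⊛ (g ⊛ h)) n)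
      ≡⟨ regroup (f 0) (g 0) (h (suc n)) _ _ ⟩
    f 0 *ℤ (g 0 *ℤ h (suc n) +ℤ ((g ∘ suc) ⊛ h) n) +ℤ ((f ∘ suc) ⊛ (g ⊛ h)) n ∎
    where
    open ≡-Reasoning
    regroup : ∀ a b c x y → a *ℤ b *ℤ c +ℤ (a *ℤ x +ℤ y) ≡ a *ℤ (b *ℤ c +ℤ x) +ℤ y
    regroup = ℤSolver.solve-∀

  ⊛-zeroˡₙ : ∀ {f} → (∀ i → f i ≡ 0ℤ) → ∀ g n → (f ⊛ g) n ≡ 0ℤ
  ⊛-zeroˡₙ z g zero    = trans (cong (_*ℤ g 0) (z 0)) (ℤₚ.*-zeroˡ (g 0))
  ⊛-zeroˡₙ z g (suc n) = cong₂ _+ℤ_ (trans (cong (_*ℤ g (suc n)) (z 0)) (ℤₚ.*-zeroˡ (g (suc n))))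
    (⊛-zeroˡₙ (z ∘ suc) g n)

  const-⊛ₙ : ∀ z g n → (const z ⊛ g) n ≡ z *ℤ g n
  const-⊛ₙ z g zero    = refl
  const-⊛ₙ z g (suc n) = trans (cong (z *ℤ g (suc n) +ℤ_) (⊛-zeroˡₙ (λ _ → refl) g n)) (ℤₚ.+-identityʳ _)

  𝟙-⊛ : ∀ g → 𝟙 ⊛ g ≈ g
  𝟙-⊛ g = coeffs λ n → trans (const-⊛ₙ 1ℤ g n) (ℤₚ.*-identityˡ (g n))

  ≈-isEquivalence : IsEquivalence _≈_
  ≈-isEquivalence = record
    { refl  = coeffs λ _ → refl
    ; sym   = λ p → coeffs λ n → sym (coeff p n)
    ; trans = λ p q → coeffs λ n → trans (coeff p n) (coeff q n) }

  ⊕-cong : ∀ {f f′ g g′} → f ≈ f′ → g ≈ g′ → f ⊕ g ≈ f′ ⊕ g′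
  ⊕-cong p q = coeffs λ n → cong₂ _+ℤ_ (coeff p n) (coeff q n)

  ⊖-cong : ∀ {f f′} → f ≈ f′ → ⊖ f ≈ ⊖ f′
  ⊖-cong p = coeffs λ n → cong -_ (coeff p n)

  ⊛-cong : ∀ {f f′ g g′} → f ≈ f′ → g ≈ g′ → f ⊛ g ≈ f′ ⊛ g′
  ⊛-cong p q = coeffs (⊛-congₙ (coeff p) (coeff q))

  ⊕-⊛-isCommutativeRing : IsCommutativeRing _≈_ _⊕_ _⊛_ ⊖_ 𝟘 𝟙
  ⊕-⊛-isCommutativeRing = record
      { isRing = record
        { +-isAbelianGroup = record
          { isGroup = record
            { isMonoid = record
              { isSemigroup = record
                { isMagma = record
                  { isEquivalence = ≈-isEquivalence
                  ; ∙-cong = ⊕-cong }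
                ; assoc = λ f g h → coeffs λ n → ℤₚ.+-assoc (f n) (g n) (h n) }
              ; identity = (λ f → coeffs λ n → trans (cong (_+ℤ f n) (𝟘-coeff n)) (ℤₚ.+-identityˡ (f n)))
                         , (λ f → coeffs λ n → trans (cong (f n +ℤ_) (𝟘-coeff n)) (ℤₚ.+-identityʳ (f n))) }
            ; inverse = (λ f → coeffs λ n → trans (ℤₚ.+-inverseˡ (f n)) (sym (𝟘-coeff n)))
                        , (λ f → coeffs λ n → trans (ℤₚ.+-inverseʳ (f n)) (sym (𝟘-coeff n)))
            ; ⁻¹-cong = ⊖-cong }
          ; comm = λ f g → coeffs λ n → ℤₚ.+-comm (f n) (g n) }
        ; *-cong = ⊛-cong
        ; *-assoc = λ f g h → coeffs (⊛-assocₙ f g h)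
        ; *-identity = 𝟙-⊛ , λ f → coeffs λ n → trans (⊛-commₙ f 𝟙 n) (coeff (𝟙-⊛ f) n)
        ; distrib = (λ f g h → coeffs λ n → trans (⊛-commₙ f (g ⊕ h) n) (trans (⊛-distribʳₙ g h f n) (cong₂ _+ℤ_ (⊛-commₙ g f n) (⊛-commₙ h f n))))
                  , (λ f g h → coeffs (⊛-distribʳₙ g h f)) }
      ; *-comm = λ f g → coeffs (⊛-commₙ f g) }

  const-+ : ∀ x y → const (x +ℤ y) ≈ const x ⊕ const y
  const-+ x y = coeffs λ { zero → refl ; (suc n) → refl }

  const-* : ∀ x y → const (x *ℤ y) ≈ const x ⊛ const y
  const-* x y = coeffs λ n → sym (trans (const-⊛ₙ x (const y) n) (scaled n))
    where
    scaled : ∀ n → x *ℤ const y n ≡ const (x *ℤ y) n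
    scaled zero    = refl
    scaled (suc n) = ℤₚ.*-zeroʳ x

  const-neg : ∀ x → const (- x) ≈ ⊖ const x
  const-neg x = coeffs λ { zero → refl ; (suc n) → refl }

seriesRing : CommutativeRing 0ℓ 0ℓ
seriesRing = record { isCommutativeRing = ⊕-⊛-isCommutativeRing }

open CommutativeRing seriesRing public
  using () renaming (setoid to ≈-setoid; refl to ≈-refl; sym to ≈-sym; trans to ≈-trans; *-assoc to ⊛-assoc; *-comm to ⊛-comm)

⊕-congˡ : ∀ {f g g′} → g ≈ g′ → f ⊕ g ≈ f ⊕ g′
⊕-congˡ = ⊕-cong ≈-refl

⊕-congʳ : ∀ {f f′ g} → f ≈ f′ → f ⊕ g ≈ f′ ⊕ g
⊕-congʳ p = ⊕-cong p ≈-refl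

⊛-congˡ : ∀ {f g g′} → g ≈ g′ → f ⊛ g ≈ f ⊛ g′
⊛-congˡ = ⊛-cong ≈-refl

⊛-congʳ : ∀ {f f′ g} → f ≈ f′ → f ⊛ g ≈ f′ ⊛ g
⊛-congʳ p = ⊛-cong p ≈-refl

almostSeriesRing : AlmostCommutativeRing 0ℓ 0ℓ
almostSeriesRing = fromCommutativeRing seriesRing

const-morphism : ℤ.+-*-rawRing -Raw-AlmostCommutative⟶ almostSeriesRing
const-morphism = record
  { ⟦_⟧    = const
  ; +-homo = const-+
  ; *-homo = const-*
  ; -‿homo = const-neg
  ; 0-homo = ≈-refl
  ; 1-homo = ≈-refl }

const-≟ : ∀ x y → Maybe (const x ≈ const y)
const-≟ x y with x ℤ.≟ y
... | yes refl = just ≈-refl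
... | no _     = nothing

module Solver = RingSolver ℤ.+-*-rawRing almostSeriesRing const-morphism const-≟
open Solver using (solve; _:+_; _:*_; _:-_; :-_; _:=_; con)

module ≈-Reasoning = SetoidReasoning ≈-setoid

≡⇒≈ : ∀ {f g : Series} → f ≡ g → f ≈ g
≡⇒≈ refl = ≈-refl

-- Powers of q and recursive equations

shift : ℕ → Series → Series
shift zero    f         = f
shift (suc k) f zero    = 0ℤ
shift (suc k) f (suc n) = shift k f n

shift-≥ : ∀ {k n} f → k ≤ n → shift k f n ≡ f (n ∸ k)
shift-≥ f z≤n       = refl
shift-≥ f (s≤s k≤n) = shift-≥ f k≤n

shift-< : ∀ {k n} f → n < k → shift k f n ≡ 0ℤ
shift-< {suc k} {zero}  f n<k       = refl
shift-< {suc k} {suc n} f (s≤s n<k) = shift-< f n<k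

shift-cong-≤ : ∀ k {f g} n → (∀ i → i ≤ n → f i ≡ g i) → shift k f n ≡ shift k g n
shift-cong-≤ zero    n       o = o n ℕₚ.≤-refl
shift-cong-≤ (suc k) zero    o = refl
shift-cong-≤ (suc k) (suc n) o = shift-cong-≤ k n λ i i≤n → o i (ℕₚ.m≤n⇒m≤1+n i≤n)

shift-cong-< : ∀ k {f g} n → (∀ i → i < n → f i ≡ g i) → shift (suc k) f n ≡ shift (suc k) g n
shift-cong-< k zero    o = refl
shift-cong-< k (suc n) o = shift-cong-≤ k n λ i i≤n → o i (s≤s i≤n)

shift-cong : ∀ k {f g} → f ≈ g → shift k f ≈ shift k g
shift-cong k o = coeffs λ n → shift-cong-≤ k n λ i _ → coeff o i

shift-⊛ : ∀ k f g → shift k f ⊛ g ≈ shift k (f ⊛ g)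
shift-⊛ k f g = coeffs (go k)
  where
  go : ∀ k n → (shift k f ⊛ g) n ≡ shift k (f ⊛ g) n
  go zero    n       = refl
  go (suc k) zero    = trans (⊛-zero-coeff (shift (suc k) f) g) (ℤₚ.*-zeroˡ (g 0))
  go (suc k) (suc n) = trans (⊛-suc-coeff (shift (suc k) f) g n)
    (trans (cong₂ _+ℤ_ (ℤₚ.*-zeroˡ (g (suc n))) (go k n)) (ℤₚ.+-identityˡ _))

X : ℕ → Series
X k = shift k 𝟙

X-⊛ : ∀ k f → X k ⊛ f ≈ shift k f
X-⊛ k f = ≈-trans (shift-⊛ k 𝟙 f) (shift-cong k (𝟙-⊛ f))

X-+ : ∀ k l → X (k + l) ≈ X k ⊛ X l
X-+ k l = ≈-trans (coeffs (go k)) (≈-sym (X-⊛ k (X l)))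
  where
  go : ∀ k n → X (k + l) n ≡ shift k (X l) n
  go zero    n       = refl
  go (suc k) zero    = refl
  go (suc k) (suc n) = go k n

-- The positive power of q lets only coefficients of `f₁` and `g₁` below `n` enter. As `f₁` need not
-- be `f`, this also serves recursions in which the counted property changes from step to step.
guarded : ∀ {f f₀ f₁ g g₀ g₁} k n → f ≈ f₀ ⊕ X (suc k) ⊛ f₁ → g ≈ g₀ ⊕ X (suc k) ⊛ g₁ →
  f₀ n ≡ g₀ n → (∀ i → i < n → f₁ i ≡ g₁ i) → f n ≡ g n
guarded {f} {f₀} {f₁} {g} {g₀} {g₁} k n f≈ g≈ eq₀ eq₁ = begin
  f n                            ≡⟨ coeff (≈-trans f≈ (⊕-congˡ (X-⊛ (suc k) f₁))) n ⟩
  (f₀ ⊕ shift (suc k) f₁) n      ≡⟨ ⊕-coeff f₀ _ n ⟩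
  f₀ n +ℤ shift (suc k) f₁ n     ≡⟨ cong₂ _+ℤ_ eq₀ (shift-cong-< k n eq₁) ⟩
  g₀ n +ℤ shift (suc k) g₁ n     ≡⟨ ⊕-coeff g₀ _ n ⟨
  (g₀ ⊕ shift (suc k) g₁) n      ≡⟨ coeff (≈-trans g≈ (⊕-congˡ (X-⊛ (suc k) g₁))) n ⟨
  g n ∎
  where open ≡-Reasoning

guarded-unique : ∀ {f f₀ g g₀} k → f ≈ f₀ ⊕ X (suc k) ⊛ f → g ≈ g₀ ⊕ X (suc k) ⊛ g → f₀ ≈ g₀ → f ≈ g
guarded-unique {f} {g = g} k f≈ g≈ eq₀ = coeffs (<-rec (λ n → f n ≡ g n) λ n rec →
  guarded k n f≈ g≈ (coeff eq₀ n) (λ i i<n → rec i<n))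

-- Gauss's theorem on triangular numbers

-- Shanks' finite form of Gauss's theorem, with Y k in the role of q^k.
module Shanks (Y : ℕ → Series) (Y-0 : Y 0 ≈ 𝟙) (Y-+ : ∀ k l → Y (k + l) ≈ Y k ⊛ Y l) where

  oddProduct : ℕ → Series
  oddProduct zero    = 𝟙
  oddProduct (suc s) = oddProduct s ⊛ (𝟙 ⊕ ⊖ Y (1 + 2 * s))

  -- The quotient (q²;q²)_(r+d) / (q²;q²)_r, written as a product.
  evenProduct : ℕ → ℕ → Series
  evenProduct r zero    = 𝟙
  evenProduct r (suc d) = (𝟙 ⊕ ⊖ Y (2 * suc r)) ⊛ evenProduct (suc r) d

  evenProduct-last : ∀ r d → evenProduct r (suc d) ≈ evenProduct r d ⊛ (𝟙 ⊕ ⊖ Y (2 * suc (r + d)))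
  evenProduct-last r zero = begin
    (𝟙 ⊕ ⊖ Y (2 * suc r)) ⊛ 𝟙       ≈⟨ ⊛-comm _ _ ⟩
    𝟙 ⊛ (𝟙 ⊕ ⊖ Y (2 * suc r))       ≡⟨ cong (λ k → 𝟙 ⊛ (𝟙 ⊕ ⊖ Y (2 * suc k))) (sym (ℕₚ.+-identityʳ r)) ⟩
    𝟙 ⊛ (𝟙 ⊕ ⊖ Y (2 * suc (r + 0))) ∎
    where open ≈-Reasoning
  evenProduct-last r (suc d) = begin
    (𝟙 ⊕ ⊖ Y (2 * suc r)) ⊛ evenProduct (suc r) (suc d)
      ≈⟨ ⊛-congˡ (evenProduct-last (suc r) d) ⟩
    (𝟙 ⊕ ⊖ Y (2 * suc r)) ⊛ (evenProduct (suc r) d ⊛ (𝟙 ⊕ ⊖ Y (2 * suc (suc r + d))))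
      ≈⟨ ⊛-assoc _ _ _ ⟨
    evenProduct r (suc d) ⊛ (𝟙 ⊕ ⊖ Y (2 * suc (suc r + d)))
      ≡⟨ cong (λ k → evenProduct r (suc d) ⊛ (𝟙 ⊕ ⊖ Y (2 * suc k))) (sym (ℕₚ.+-suc r d)) ⟩
    evenProduct r (suc d) ⊛ (𝟙 ⊕ ⊖ Y (2 * suc (r + suc d))) ∎
    where open ≈-Reasoning

  -- Shanks' summand is q^(s(2N+1)) P_N / P_s with P_k = (q²;q²)_k / (q;q²)_k. Multiplication by
  -- (q;q²)_N clears the denominators and puts `oddProduct N` on the other side of `shanks`.
  shanksTerm : ℕ → ℕ → Series
  shanksTerm N s = Y (s * (2 * N + 1)) ⊛ oddProduct s ⊛ evenProduct s (N ∸ s)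

  shanksSum : ℕ → ℕ → Series
  shanksSum N zero    = 𝟘
  shanksSum N (suc r) = shanksSum N r ⊕ shanksTerm N r

  -- The exponents added in one step are the triangular numbers of index 2N and 2N+1.
  triangularSum : ℕ → Series
  triangularSum zero    = 𝟘
  triangularSum (suc N) = triangularSum N ⊕ (Y (N * (2 * N + 1)) ⊕ Y ((N + 1) * (2 * N + 1)))

  Y-split : ∀ {n} k l → n ≡ k + l → Y n ≈ Y k ⊛ Y l
  Y-split k l refl = Y-+ k l

  shanksTerm-suc : ∀ {r N} → r ≤ N → shanksTerm (suc N) r ≈
    Y (r * (2 * N + 1)) ⊛ Y (2 * r) ⊛ oddProduct r ⊛ (evenProduct r (N ∸ r) ⊛ (𝟙 ⊕ ⊖ (Y (1 + 2 * N) ⊛ Y 1)))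
  shanksTerm-suc {r} {N} r≤N = ⊛-cong (⊛-congʳ (Y-split (r * (2 * N + 1)) (2 * r) (split r N))) (begin
    evenProduct r (suc N ∸ r)
      ≡⟨ cong (evenProduct r) (ℕₚ.+-∸-assoc 1 r≤N) ⟩
    evenProduct r (suc (N ∸ r))
      ≈⟨ evenProduct-last r (N ∸ r) ⟩
    evenProduct r (N ∸ r) ⊛ (𝟙 ⊕ ⊖ Y (2 * suc (r + (N ∸ r))))
      ≡⟨ cong (λ k → evenProduct r (N ∸ r) ⊛ (𝟙 ⊕ ⊖ Y (2 * suc k))) (ℕₚ.m+[n∸m]≡n r≤N) ⟩
    evenProduct r (N ∸ r) ⊛ (𝟙 ⊕ ⊖ Y (2 * suc N))
      ≈⟨ ⊛-congˡ (⊕-congˡ (⊖-cong (Y-split (1 + 2 * N) 1 (next N)))) ⟩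
    evenProduct r (N ∸ r) ⊛ (𝟙 ⊕ ⊖ (Y (1 + 2 * N) ⊛ Y 1)) ∎)
    where
    open ≈-Reasoning
    split : ∀ r N → r * (2 * suc N + 1) ≡ r * (2 * N + 1) + 2 * r
    split = solve-∀
    next : ∀ N → 2 * suc N ≡ 1 + 2 * N + 1
    next = solve-∀

  -- The difference between two consecutive Shanks sums telescopes; its partial sums have this closed form.
  shanksSum-suc : ∀ N r → r ≤ N → shanksSum (suc N) r ≈
    (𝟙 ⊕ ⊖ Y (1 + 2 * N)) ⊛ shanksSum N r
      ⊕ Y (r * (2 * N + 1)) ⊛ (𝟙 ⊕ ⊖ Y (2 * r)) ⊛ evenProduct r (N ∸ r) ⊛ oddProduct r
  shanksSum-suc N zero _ = begin
    𝟘
      ≈⟨ solve 2 (λ b e → con 0ℤ := b :* con 0ℤ :+ con 1ℤ :* (con 1ℤ :- con 1ℤ) :* e :* con 1ℤ)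
           ≈-refl (𝟙 ⊕ ⊖ Y (1 + 2 * N)) (evenProduct 0 N) ⟩
    (𝟙 ⊕ ⊖ Y (1 + 2 * N)) ⊛ 𝟘 ⊕ 𝟙 ⊛ (𝟙 ⊕ ⊖ 𝟙) ⊛ evenProduct 0 N ⊛ 𝟙
      ≈⟨ ⊕-congˡ (⊛-congʳ (⊛-congʳ (⊛-cong Y-0 (⊕-congˡ (⊖-cong Y-0))))) ⟨
    (𝟙 ⊕ ⊖ Y (1 + 2 * N)) ⊛ 𝟘 ⊕ Y 0 ⊛ (𝟙 ⊕ ⊖ Y 0) ⊛ evenProduct 0 N ⊛ 𝟙 ∎
    where open ≈-Reasoning
  shanksSum-suc N (suc r) r<N = begin
    shanksSum (suc N) r ⊕ shanksTerm (suc N) r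
      ≈⟨ ⊕-cong (shanksSum-suc N r (ℕₚ.<⇒≤ r<N)) (shanksTerm-suc (ℕₚ.<⇒≤ r<N)) ⟩
    (𝟙 ⊕ ⊖ o) ⊛ Z ⊕ u ⊛ (𝟙 ⊕ ⊖ v) ⊛ evenProduct r (N ∸ r) ⊛ b ⊕ u ⊛ v ⊛ b ⊛ (evenProduct r (N ∸ r) ⊛ (𝟙 ⊕ ⊖ (o ⊛ y)))
      ≈⟨ ⊕-cong (⊕-congˡ (⊛-congʳ (⊛-congˡ unfold))) (⊛-congˡ (⊛-congʳ unfold)) ⟩
    (𝟙 ⊕ ⊖ o) ⊛ Z ⊕ u ⊛ (𝟙 ⊕ ⊖ v) ⊛ ((𝟙 ⊕ ⊖ w) ⊛ e) ⊛ b ⊕ u ⊛ v ⊛ b ⊛ ((𝟙 ⊕ ⊖ w) ⊛ e ⊛ (𝟙 ⊕ ⊖ (o ⊛ y)))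
      -- Beside (1 - o) Z, both sides are u b (1 - w) e times 1 - o y v: on the left as (1 - v) + v
      -- (1 - o y), on the right as (1 - o) + o (1 - y v).
      ≈⟨ solve 8 (λ o Z u v w e b y →
           (con 1ℤ :- o) :* Z :+ u :* (con 1ℤ :- v) :* ((con 1ℤ :- w) :* e) :* b :+ u :* v :* b :* ((con 1ℤ :- w) :* e :* (con 1ℤ :- (o :* y)))
           := (con 1ℤ :- o) :* (Z :+ u :* b :* ((con 1ℤ :- w) :* e)) :+ (o :* u) :* (con 1ℤ :- w) :* e :* (b :* (con 1ℤ :- y :* v)))
         ≈-refl o Z u v w e b y ⟩
    (𝟙 ⊕ ⊖ o) ⊛ (Z ⊕ u ⊛ b ⊛ ((𝟙 ⊕ ⊖ w) ⊛ e)) ⊕ (o ⊛ u) ⊛ (𝟙 ⊕ ⊖ w) ⊛ e ⊛ (b ⊛ (𝟙 ⊕ ⊖ (y ⊛ v)))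
      ≈⟨ ⊕-cong (⊛-congˡ (⊕-congˡ (⊛-congˡ unfold)))
           (⊛-cong (⊛-congʳ (⊛-congʳ (Y-split (1 + 2 * N) (r * (2 * N + 1)) (next r N)))) (⊛-congˡ (⊕-congˡ (⊖-cong (Y-+ 1 (2 * r)))))) ⟨
    (𝟙 ⊕ ⊖ o) ⊛ (Z ⊕ shanksTerm N r) ⊕ Y (suc r * (2 * N + 1)) ⊛ (𝟙 ⊕ ⊖ w) ⊛ e ⊛ oddProduct (suc r) ∎
    where
    open ≈-Reasoning
    o = Y (1 + 2 * N)
    Z = shanksSum N r
    u = Y (r * (2 * N + 1))
    v = Y (2 * r)
    w = Y (2 * suc r)
    y = Y 1
    e = evenProduct (suc r) (N ∸ suc r)
    b = oddProduct r
    unfold : evenProduct r (N ∸ r) ≈ (𝟙 ⊕ ⊖ w) ⊛ e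
    unfold = ≡⇒≈ (cong (evenProduct r) (ℕₚ.+-∸-assoc 1 r<N))
    next : ∀ r N → suc r * (2 * N + 1) ≡ (1 + 2 * N) + r * (2 * N + 1)
    next = solve-∀

  shanks : ∀ N → shanksSum N N ≈ oddProduct N ⊛ triangularSum N
  shanks zero    = solve 0 (con 0ℤ := con 1ℤ :* con 0ℤ) ≈-refl
  shanks (suc N) = begin
    shanksSum (suc N) N ⊕ shanksTerm (suc N) N
      ≈⟨ ⊕-cong (shanksSum-suc N N ℕₚ.≤-refl) (shanksTerm-suc {N} {N} ℕₚ.≤-refl) ⟩
    (𝟙 ⊕ ⊖ o) ⊛ shanksSum N N ⊕ u ⊛ (𝟙 ⊕ ⊖ v) ⊛ evenProduct N (N ∸ N) ⊛ b ⊕ u ⊛ v ⊛ b ⊛ (evenProduct N (N ∸ N) ⊛ (𝟙 ⊕ ⊖ (o ⊛ y)))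
      ≈⟨ ⊕-cong (⊕-cong (⊛-congˡ (shanks N)) (⊛-congʳ (⊛-congˡ empty))) (⊛-congˡ (⊛-cong empty (⊕-congˡ (⊖-cong (⊛-congʳ (Y-+ 1 (2 * N))))))) ⟩
    (𝟙 ⊕ ⊖ o) ⊛ (b ⊛ θ) ⊕ u ⊛ (𝟙 ⊕ ⊖ v) ⊛ 𝟙 ⊛ b ⊕ u ⊛ v ⊛ b ⊛ (𝟙 ⊛ (𝟙 ⊕ ⊖ (y ⊛ v ⊛ y)))
      ≈⟨ ⊕-congʳ (⊕-congʳ (⊛-congʳ (⊕-congˡ (⊖-cong (Y-+ 1 (2 * N)))))) ⟩
    (𝟙 ⊕ ⊖ (y ⊛ v)) ⊛ (b ⊛ θ) ⊕ u ⊛ (𝟙 ⊕ ⊖ v) ⊛ 𝟙 ⊛ b ⊕ u ⊛ v ⊛ b ⊛ (𝟙 ⊛ (𝟙 ⊕ ⊖ (y ⊛ v ⊛ y)))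
      -- Here (1 - v) + v (1 - y² v) = (1 - y v)(1 + y v): the first factor extends `oddProduct`,
      -- the second yields the two new powers u and y v u.
      ≈⟨ solve 5 (λ b θ u v y →
           (con 1ℤ :- y :* v) :* (b :* θ) :+ u :* (con 1ℤ :- v) :* con 1ℤ :* b :+ u :* v :* b :* (con 1ℤ :* (con 1ℤ :- y :* v :* y))
           := b :* (con 1ℤ :- y :* v) :* (θ :+ (u :+ y :* v :* u)))
         ≈-refl b θ u v y ⟩
    b ⊛ (𝟙 ⊕ ⊖ (y ⊛ v)) ⊛ (θ ⊕ (u ⊕ y ⊛ v ⊛ u))
      ≈⟨ ⊛-cong (⊛-congˡ (⊕-congˡ (⊖-cong (Y-+ 1 (2 * N)))))
           (⊕-congˡ (⊕-congˡ (≈-trans (Y-split (1 + 2 * N) (N * (2 * N + 1)) (next N)) (⊛-congʳ (Y-+ 1 (2 * N)))))) ⟨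
    oddProduct (suc N) ⊛ triangularSum (suc N) ∎
    where
    open ≈-Reasoning
    o = Y (1 + 2 * N)
    u = Y (N * (2 * N + 1))
    v = Y (2 * N)
    y = Y 1
    b = oddProduct N
    θ = triangularSum N
    empty : evenProduct N (N ∸ N) ≈ 𝟙
    empty = ≡⇒≈ (cong (evenProduct N) (ℕₚ.n∸n≡0 N))
    next : ∀ N → (N + 1) * (2 * N + 1) ≡ (1 + 2 * N) + N * (2 * N + 1)
    next = solve-∀

  -- Every term with s ≥ 1 is divisible by `Y (2 * N + 1)`, so up to that order only the term s = 0
  -- remains, which is (q²;q²)_N. This takes the place of letting N tend to infinity.
  shanksSum-remainder : ∀ N r → ∃ λ R → shanksSum N (suc r) ≈ evenProduct 0 N ⊕ Y (2 * N + 1) ⊛ R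
  shanksSum-remainder N zero = 𝟘 , (begin
    𝟘 ⊕ Y 0 ⊛ 𝟙 ⊛ e       ≈⟨ ⊕-congˡ (⊛-congʳ (⊛-congʳ Y-0)) ⟩
    𝟘 ⊕ 𝟙 ⊛ 𝟙 ⊛ e
      ≈⟨ solve 2 (λ e y → con 0ℤ :+ con 1ℤ :* con 1ℤ :* e := e :+ y :* con 0ℤ) ≈-refl e (Y (2 * N + 1)) ⟩
    e ⊕ Y (2 * N + 1) ⊛ 𝟘 ∎)
    where
    open ≈-Reasoning
    e = evenProduct 0 N
  shanksSum-remainder N (suc r) = let R , eq = shanksSum-remainder N r in R ⊕ u ⊛ b ⊛ t , (begin
    shanksSum N (suc r) ⊕ Y (suc r * (2 * N + 1)) ⊛ b ⊛ t
      ≈⟨ ⊕-cong eq (⊛-congʳ (⊛-congʳ (Y-+ (2 * N + 1) (r * (2 * N + 1))))) ⟩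
    e ⊕ Y (2 * N + 1) ⊛ R ⊕ Y (2 * N + 1) ⊛ u ⊛ b ⊛ t
      ≈⟨ solve 6 (λ e y R u b t → e :+ y :* R :+ y :* u :* b :* t := e :+ y :* (R :+ u :* b :* t))
           ≈-refl e (Y (2 * N + 1)) R u b t ⟩
    e ⊕ Y (2 * N + 1) ⊛ (R ⊕ u ⊛ b ⊛ t) ∎)
    where
    open ≈-Reasoning
    e = evenProduct 0 N
    u = Y (r * (2 * N + 1))
    b = oddProduct (suc r)
    t = evenProduct (suc r) (N ∸ suc r)

-1^even : ∀ k → -1ℤ ^ (2 * k) ≡ 1ℤ
-1^even k = trans (sym (ℤₚ.^-*-assoc -1ℤ 2 k)) (ℤₚ.^-zeroˡ k)

-1^[k+2l] : ∀ k l → -1ℤ ^ (k + 2 * l) ≡ -1ℤ ^ k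
-1^[k+2l] k l = trans (ℤₚ.^-distribˡ-+-* -1ℤ k (2 * l))
  (trans (cong (-1ℤ ^ k *ℤ_) (-1^even l)) (ℤₚ.*-identityʳ (-1ℤ ^ k)))

-- The power (-q)^k. Shanks' identity is wanted at -q because there the triangular exponents acquire
-- the signs of the theorem, and (q;q²) becomes (-q;q²).
Y : ℕ → Series
Y k = const (-1ℤ ^ k) ⊛ X k

Y-0 : Y 0 ≈ 𝟙
Y-0 = 𝟙-⊛ 𝟙

Y-+ : ∀ k l → Y (k + l) ≈ Y k ⊛ Y l
Y-+ k l = begin
  const (-1ℤ ^ (k + l)) ⊛ X (k + l)
    ≡⟨ cong (λ z → const z ⊛ X (k + l)) (ℤₚ.^-distribˡ-+-* -1ℤ k l) ⟩
  const (-1ℤ ^ k *ℤ -1ℤ ^ l) ⊛ X (k + l)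
    ≈⟨ ⊛-cong (const-* (-1ℤ ^ k) (-1ℤ ^ l)) (X-+ k l) ⟩
  const (-1ℤ ^ k) ⊛ const (-1ℤ ^ l) ⊛ (X k ⊛ X l)
    ≈⟨ solve 4 (λ a b c d → a :* b :* (c :* d) := a :* c :* (b :* d))
         ≈-refl (const (-1ℤ ^ k)) (const (-1ℤ ^ l)) (X k) (X l) ⟩
  Y k ⊛ Y l ∎
  where open ≈-Reasoning

Y-even : ∀ k → Y (2 * k) ≈ X (2 * k)
Y-even k = ≈-trans (⊛-congʳ (≡⇒≈ (cong const (-1^even k)))) (𝟙-⊛ (X (2 * k)))

Y-odd : ∀ k → Y (1 + 2 * k) ≈ ⊖ X (1 + 2 * k)
Y-odd k = ≈-trans (⊛-congʳ (≡⇒≈ (cong const (-1^[k+2l] 1 k))))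
  (solve 1 (λ x → con -1ℤ :* x := :- x) ≈-refl (X (1 + 2 * k)))

Y-⊛-< : ∀ {k n} f → n < k → (Y k ⊛ f) n ≡ 0ℤ
Y-⊛-< {k} {n} f n<k = trans (coeff eq n) (trans (const-⊛ₙ (-1ℤ ^ k) (shift k f) n)
  (trans (cong (-1ℤ ^ k *ℤ_) (shift-< f n<k)) (ℤₚ.*-zeroʳ (-1ℤ ^ k))))
  where
  eq : Y k ⊛ f ≈ const (-1ℤ ^ k) ⊛ shift k f
  eq = ≈-trans (⊛-assoc (const (-1ℤ ^ k)) (X k) f) (⊛-congˡ (X-⊛ k f))

open Shanks Y Y-0 Y-+ public

-- P M and G N stand for the generating functions of the partitions into parts ≤ M
-- and into parts from 2, 6, …, 4N - 2.
module Gauss (P G : ℕ → Series)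
  (P-0 : P 0 ≈ 𝟙) (P-suc : ∀ M → P (suc M) ≈ P M ⊕ X (suc M) ⊛ P (suc M))
  (G-0 : G 0 ≈ 𝟙) (G-suc : ∀ N → G (suc N) ≈ G N ⊕ X (2 * (1 + 2 * N)) ⊛ G (suc N)) where

  -- Since `oddProduct` is now (-q;q²)_N, its companion (q;q²)_N serves twice: the product of the
  -- two is (q²;q⁴)_N, the inverse of `G N`, and together with (q²;q²)_N it gives (q;q)_(2N), the
  -- inverse of `P (2 * N)`.
  oddProduct⁻ : ℕ → Series
  oddProduct⁻ zero    = 𝟙
  oddProduct⁻ (suc s) = oddProduct⁻ s ⊛ (𝟙 ⊕ ⊖ X (1 + 2 * s))

  divide : ∀ {f g x} → f ≈ g ⊕ x ⊛ f → (𝟙 ⊕ ⊖ x) ⊛ f ≈ g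
  divide {f} {g} {x} eq = begin
    (𝟙 ⊕ ⊖ x) ⊛ f           ≈⟨ solve 2 (λ x f → (con 1ℤ :- x) :* f := f :- x :* f) ≈-refl x f ⟩
    f ⊕ ⊖ (x ⊛ f)           ≈⟨ ⊕-congʳ eq ⟩
    g ⊕ x ⊛ f ⊕ ⊖ (x ⊛ f)   ≈⟨ solve 2 (λ g h → g :+ h :- h := g) ≈-refl g (x ⊛ f) ⟩
    g ∎
    where open ≈-Reasoning

  G-inverse : ∀ N → oddProduct N ⊛ oddProduct⁻ N ⊛ G N ≈ 𝟙
  G-inverse zero    = ≈-trans (⊛-cong (𝟙-⊛ 𝟙) G-0) (𝟙-⊛ 𝟙)
  G-inverse (suc N) = begin
    b ⊛ (𝟙 ⊕ ⊖ Y (1 + 2 * N)) ⊛ (c ⊛ (𝟙 ⊕ ⊖ x)) ⊛ G (suc N)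
      ≈⟨ ⊛-congʳ (⊛-congʳ (⊛-congˡ (⊕-congˡ (⊖-cong (Y-odd N))))) ⟩
    b ⊛ (𝟙 ⊕ ⊖ ⊖ x) ⊛ (c ⊛ (𝟙 ⊕ ⊖ x)) ⊛ G (suc N)
      ≈⟨ solve 4 (λ b x c g → b :* (con 1ℤ :- :- x) :* (c :* (con 1ℤ :- x)) :* g := b :* c :* ((con 1ℤ :- x :* x) :* g))
           ≈-refl b x c (G (suc N)) ⟩
    b ⊛ c ⊛ ((𝟙 ⊕ ⊖ (x ⊛ x)) ⊛ G (suc N))
      ≈⟨ ⊛-congˡ (⊛-congʳ (⊕-congˡ (⊖-cong double))) ⟨
    b ⊛ c ⊛ ((𝟙 ⊕ ⊖ X (2 * (1 + 2 * N))) ⊛ G (suc N))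
      ≈⟨ ⊛-congˡ (divide (G-suc N)) ⟩
    b ⊛ c ⊛ G N
      ≈⟨ G-inverse N ⟩
    𝟙 ∎
    where
    open ≈-Reasoning
    b = oddProduct N
    c = oddProduct⁻ N
    x = X (1 + 2 * N)
    double : X (2 * (1 + 2 * N)) ≈ x ⊛ x
    double = ≈-trans (≡⇒≈ (cong (λ k → X ((1 + 2 * N) + k)) (ℕₚ.+-identityʳ (1 + 2 * N)))) (X-+ (1 + 2 * N) (1 + 2 * N))

  P-inverse : ∀ N → evenProduct 0 N ⊛ oddProduct⁻ N ⊛ P (2 * N) ≈ 𝟙
  P-inverse zero    = ≈-trans (⊛-cong (𝟙-⊛ 𝟙) P-0) (𝟙-⊛ 𝟙)
  P-inverse (suc N) = begin
    evenProduct 0 (suc N) ⊛ (c ⊛ (𝟙 ⊕ ⊖ x)) ⊛ P (2 * suc N)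
      ≈⟨ ⊛-congʳ (⊛-congʳ (≈-trans (evenProduct-last 0 N) (⊛-congˡ (⊕-congˡ (⊖-cong (Y-even (suc N))))))) ⟩
    e ⊛ (𝟙 ⊕ ⊖ X (2 * suc N)) ⊛ (c ⊛ (𝟙 ⊕ ⊖ x)) ⊛ P (2 * suc N)
      ≡⟨ cong (λ k → e ⊛ (𝟙 ⊕ ⊖ X k) ⊛ (c ⊛ (𝟙 ⊕ ⊖ x)) ⊛ P k) (next N) ⟩
    e ⊛ (𝟙 ⊕ ⊖ x′) ⊛ (c ⊛ (𝟙 ⊕ ⊖ x)) ⊛ P (suc (1 + 2 * N))
      ≈⟨ solve 5 (λ e x′ c x h → e :* (con 1ℤ :- x′) :* (c :* (con 1ℤ :- x)) :* h := e :* c :* ((con 1ℤ :- x) :* ((con 1ℤ :- x′) :* h)))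
           ≈-refl e x′ c x (P (suc (1 + 2 * N))) ⟩
    e ⊛ c ⊛ ((𝟙 ⊕ ⊖ x) ⊛ ((𝟙 ⊕ ⊖ x′) ⊛ P (suc (1 + 2 * N))))
      ≈⟨ ⊛-congˡ (≈-trans (⊛-congˡ (divide (P-suc (1 + 2 * N)))) (divide (P-suc (2 * N)))) ⟩
    e ⊛ c ⊛ P (2 * N)
      ≈⟨ P-inverse N ⟩
    𝟙 ∎
    where
    open ≈-Reasoning
    e = evenProduct 0 N
    c = oddProduct⁻ N
    x = X (1 + 2 * N)
    x′ = X (suc (1 + 2 * N))
    next : ∀ N → 2 * suc N ≡ suc (1 + 2 * N)
    next = solve-∀

  -- Shanks' identity reads b t = e + y R. Multiplying by c h g and cancelling b c g = 1 and e c h =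
  -- 1 leaves t h = g + y (R c h g), whose last term starts only at q^(2(N+1)+1).
  gauss : ∀ N n → n < 2 * suc N + 1 → (triangularSum (suc N) ⊛ P (2 * suc N)) n ≡ G (suc N) n
  gauss N n n< = begin
    (t ⊛ h) n                    ≡⟨ coeff expand n ⟩
    (g ⊕ y ⊛ (R ⊛ c ⊛ h ⊛ g)) n   ≡⟨ ⊕-coeff _ _ n ⟩
    g n +ℤ (y ⊛ (R ⊛ c ⊛ h ⊛ g)) n ≡⟨ cong (g n +ℤ_) (Y-⊛-< (R ⊛ c ⊛ h ⊛ g) n<) ⟩
    g n +ℤ 0ℤ                    ≡⟨ ℤₚ.+-identityʳ (g n) ⟩
    g n ∎
    where
    open ≡-Reasoning
    t = triangularSum (suc N)
    h = P (2 * suc N)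
    g = G (suc N)
    b = oddProduct (suc N)
    c = oddProduct⁻ (suc N)
    e = evenProduct 0 (suc N)
    y = Y (2 * suc N + 1)
    R = proj₁ (shanksSum-remainder (suc N) N)
    expand : t ⊛ h ≈ g ⊕ y ⊛ (R ⊛ c ⊛ h ⊛ g)
    expand = E.begin
      t ⊛ h E.≈⟨ ≈-trans (⊛-comm (t ⊛ h) 𝟙) (𝟙-⊛ (t ⊛ h)) ⟨
      t ⊛ h ⊛ 𝟙 E.≈⟨ ⊛-congˡ (G-inverse (suc N)) ⟨
      t ⊛ h ⊛ (b ⊛ c ⊛ g)
        E.≈⟨ solve 5 (λ t h b c g → t :* h :* (b :* c :* g) := (b :* t) :* (h :* c :* g)) ≈-refl t h b c g ⟩
      (b ⊛ t) ⊛ (h ⊛ c ⊛ g)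
        E.≈⟨ ⊛-congʳ (≈-trans (≈-sym (shanks (suc N))) (proj₂ (shanksSum-remainder (suc N) N))) ⟩
      (e ⊕ y ⊛ R) ⊛ (h ⊛ c ⊛ g)
        E.≈⟨ solve 6 (λ e y R h c g → (e :+ y :* R) :* (h :* c :* g) := (e :* c :* h) :* g :+ y :* (R :* c :* h :* g))
             ≈-refl e y R h c g ⟩
      (e ⊛ c ⊛ h) ⊛ g ⊕ y ⊛ (R ⊛ c ⊛ h ⊛ g)
        E.≈⟨ ⊕-congʳ (≈-trans (⊛-congʳ (P-inverse (suc N))) (𝟙-⊛ g)) ⟩
      g ⊕ y ⊛ (R ⊛ c ⊛ h ⊛ g) E.∎
      where module E = ≈-Reasoning

-- The enumeration of partitions as a recursion on the largest allowed part

firstParts : ℕ → ℕ → List ℕ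
firstParts m k = filter (_≤? m) (map suc (upTo k))

firstParts-suc : ∀ m k → firstParts m (suc k) ≡ firstParts m k ++ filter (_≤? m) [ suc k ]
firstParts-suc m k = begin
  filter (_≤? m) (map suc (upTo (suc k)))    ≡⟨ cong (filter (_≤? m) ∘ map suc) (sym (Listₚ.upTo-∷ʳ k)) ⟩
  filter (_≤? m) (map suc (upTo k ++ [ k ])) ≡⟨ cong (filter (_≤? m)) (Listₚ.map-++ suc (upTo k) [ k ]) ⟩
  filter (_≤? m) (map suc (upTo k) ++ [ suc k ]) ≡⟨ Listₚ.filter-++ (_≤? m) (map suc (upTo k)) [ suc k ] ⟩
  firstParts m k ++ filter (_≤? m) [ suc k ] ∎
  where open ≡-Reasoning

firstParts-≥ : ∀ {m k} → k ≤ m → firstParts (suc m) k ≡ firstParts m k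
firstParts-≥ {m} {zero}  _   = refl
firstParts-≥ {m} {suc k} k<m = begin
  firstParts (suc m) (suc k)                          ≡⟨ firstParts-suc (suc m) k ⟩
  firstParts (suc m) k ++ filter (_≤? suc m) [ suc k ]
    ≡⟨ cong₂ _++_ (firstParts-≥ (ℕₚ.<⇒≤ k<m)) (Listₚ.filter-accept (_≤? suc m) (ℕₚ.m≤n⇒m≤1+n k<m)) ⟩
  firstParts m k ++ [ suc k ]
    ≡⟨ cong (firstParts m k ++_) (Listₚ.filter-accept (_≤? m) k<m) ⟨
  firstParts m k ++ filter (_≤? m) [ suc k ]          ≡⟨ firstParts-suc m k ⟨
  firstParts m (suc k) ∎
  where open ≡-Reasoning

firstParts-< : ∀ {m k} → m < k → firstParts (suc m) k ≡ firstParts m k ++ [ suc m ]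
firstParts-< {m} {suc k} (s≤s m≤k) with ℕₚ.m≤n⇒m<n∨m≡n m≤k
... | inj₂ refl = begin
  firstParts (suc m) (suc m)                          ≡⟨ firstParts-suc (suc m) m ⟩
  firstParts (suc m) m ++ filter (_≤? suc m) [ suc m ]
    ≡⟨ cong₂ _++_ (firstParts-≥ {m} {m} ℕₚ.≤-refl) (Listₚ.filter-accept (_≤? suc m) ℕₚ.≤-refl) ⟩
  firstParts m m ++ [ suc m ]
    ≡⟨ cong (_++ [ suc m ]) (Listₚ.++-identityʳ (firstParts m m)) ⟨
  (firstParts m m ++ []) ++ [ suc m ]
    ≡⟨ cong (λ xs → (firstParts m m ++ xs) ++ [ suc m ]) (Listₚ.filter-reject (_≤? m) ℕₚ.1+n≰n) ⟨
  (firstParts m m ++ filter (_≤? m) [ suc m ]) ++ [ suc m ] ≡⟨ cong (_++ [ suc m ]) (firstParts-suc m m) ⟨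
  firstParts m (suc m) ++ [ suc m ] ∎
  where open ≡-Reasoning
... | inj₁ m<k = begin
  firstParts (suc m) (suc k)                          ≡⟨ firstParts-suc (suc m) k ⟩
  firstParts (suc m) k ++ filter (_≤? suc m) [ suc k ]
    ≡⟨ cong (firstParts (suc m) k ++_) (Listₚ.filter-reject (_≤? suc m) (ℕₚ.<⇒≱ (s≤s m<k))) ⟩
  firstParts (suc m) k ++ []                          ≡⟨ Listₚ.++-identityʳ _ ⟩
  firstParts (suc m) k                                ≡⟨ firstParts-< m<k ⟩
  firstParts m k ++ [ suc m ]
    ≡⟨ cong (_++ [ suc m ]) (Listₚ.++-identityʳ (firstParts m k)) ⟨
  (firstParts m k ++ []) ++ [ suc m ]
    ≡⟨ cong (λ xs → (firstParts m k ++ xs) ++ [ suc m ]) (Listₚ.filter-reject (_≤? m) (ℕₚ.<⇒≱ (ℕₚ.m≤n⇒m≤1+n m<k))) ⟨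
  (firstParts m k ++ filter (_≤? m) [ suc k ]) ++ [ suc m ] ≡⟨ cong (_++ [ suc m ]) (firstParts-suc m k) ⟨
  firstParts m (suc k) ++ [ suc m ] ∎
  where open ≡-Reasoning

concatMap-cong-All : ∀ {A B : Set} {f g : A → List B} {xs} → All (λ x → f x ≡ g x) xs → concatMap f xs ≡ concatMap g xs
concatMap-cong-All []       = refl
concatMap-cong-All (p ∷ ps) = cong₂ _++_ p (concatMap-cong-All ps)

startingWith : ℕ → ℕ → ℕ → List (List ℕ)
startingWith f n j = map (j ∷_) (partsUpTo f (suc n ∸ j) j)

partsUpTo-fuel : ∀ f g {n} m → n ≤ f → n ≤ g → partsUpTo f n m ≡ partsUpTo g n m
partsUpTo-fuel f g {zero} m _ _ = refl
partsUpTo-fuel (suc f) (suc g) {suc n} m (s≤s n≤f) (s≤s n≤g) =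
  concatMap-cong-All {f = startingWith f n} {startingWith g n} {firstParts m (suc n)}
    (Allₚ.filter⁺ (_≤? m) (Allₚ.map⁺ {f = suc} (All.universal sameTail (upTo (suc n)))))
  where
  sameTail : ∀ i → startingWith f n (suc i) ≡ startingWith g n (suc i)
  sameTail i = cong (map (suc i ∷_)) (partsUpTo-fuel f g (suc i)
    (ℕₚ.≤-trans (ℕₚ.m∸n≤m n i) n≤f) (ℕₚ.≤-trans (ℕₚ.m∸n≤m n i) n≤g))

-- The definition branches over all possible first parts; generating functions need the two-way
-- branch on whether the largest allowed part is used. Raising the bound appends a single candidate
-- at the end, and `partsUpTo-fuel` trims the fuel left over for the tail.
partsUpTo-< : ∀ {m n} → m ≤ n → partsUpTo (suc n) (suc n) (suc m)
  ≡ partsUpTo (suc n) (suc n) m ++ map (suc m ∷_) (partsUpTo (n ∸ m) (n ∸ m) (suc m))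
partsUpTo-< {m} {n} m≤n = begin
  concatMap F (firstParts (suc m) (suc n))                 ≡⟨ cong (concatMap F) (firstParts-< (s≤s m≤n)) ⟩
  concatMap F (firstParts m (suc n) ++ [ suc m ])
    ≡⟨ Listₚ.concatMap-++ F (firstParts m (suc n)) [ suc m ] ⟩
  concatMap F (firstParts m (suc n)) ++ (F (suc m) ++ [])
    ≡⟨ cong (concatMap F (firstParts m (suc n)) ++_) (Listₚ.++-identityʳ _) ⟩
  concatMap F (firstParts m (suc n)) ++ F (suc m)
    ≡⟨ cong (λ ps → concatMap F (firstParts m (suc n)) ++ map (suc m ∷_) ps) (partsUpTo-fuel n (n ∸ m) (suc m) (ℕₚ.m∸n≤m n m) ℕₚ.≤-refl) ⟩
  concatMap F (firstParts m (suc n)) ++ map (suc m ∷_) (partsUpTo (n ∸ m) (n ∸ m) (suc m)) ∎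
  where
  open ≡-Reasoning
  F = startingWith n n

partsUpTo-≥ : ∀ {m n} → n ≤ m → partsUpTo n n (suc m) ≡ partsUpTo n n m
partsUpTo-≥ {m} {zero}  _   = refl
partsUpTo-≥ {m} {suc n} n<m = cong (concatMap _) (firstParts-≥ n<m)

-- Generating functions of partitions with a given property

countUpTo : (List ℕ → Bool) → ℕ → ℕ → ℕ
countUpTo P m n = length (filter (λ μ → P μ Bool.≟ true) (partsUpTo n n m))

length-filter-map : ∀ (P : List ℕ → Bool) (h : List ℕ → List ℕ) xss →
  length (filter (λ μ → P μ Bool.≟ true) (map h xss)) ≡ length (filter (λ μ → P (h μ) Bool.≟ true) xss)
length-filter-map P h []         = refl
length-filter-map P h (xs ∷ xss) with P (h xs)
... | true  = cong suc (length-filter-map P h xss)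
... | false = length-filter-map P h xss

genSeries : (List ℕ → Bool) → ℕ → Series
genSeries P m n = + countUpTo P m n

genSeries-sucₙ : ∀ P m n → genSeries P (suc m) n ≡ genSeries P m n +ℤ shift (suc m) (genSeries (P ∘ (suc m ∷_)) (suc m)) n
genSeries-sucₙ P m zero    = sym (ℤₚ.+-identityʳ _)
genSeries-sucₙ P m (suc n) with m ≤? n
... | yes m≤n = begin
  + length (filter P? (partsUpTo (suc n) (suc n) (suc m)))
    ≡⟨ cong (λ xs → + length (filter P? xs)) (partsUpTo-< m≤n) ⟩
  + length (filter P? (as ++ map (suc m ∷_) bs))
    ≡⟨ cong (λ xs → + length xs) (Listₚ.filter-++ P? as _) ⟩
  + length (filter P? as ++ filter P? (map (suc m ∷_) bs))
    ≡⟨ cong +_ (Listₚ.length-++ (filter P? as)) ⟩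
  + (countUpTo P m (suc n) + length (filter P? (map (suc m ∷_) bs)))
    ≡⟨ cong (λ k → + (countUpTo P m (suc n) + k)) (length-filter-map P (suc m ∷_) bs) ⟩
  + countUpTo P m (suc n) +ℤ + countUpTo (P ∘ (suc m ∷_)) (suc m) (n ∸ m)
    ≡⟨ cong (+ countUpTo P m (suc n) +ℤ_) (shift-≥ _ m≤n) ⟨
  + countUpTo P m (suc n) +ℤ shift m (genSeries (P ∘ (suc m ∷_)) (suc m)) n ∎
  where
  open ≡-Reasoning
  P? = λ μ → P μ Bool.≟ true
  as = partsUpTo (suc n) (suc n) m
  bs = partsUpTo (n ∸ m) (n ∸ m) (suc m)
... | no m≰n = begin
  + length (filter P? (partsUpTo (suc n) (suc n) (suc m)))
    ≡⟨ cong (λ xs → + length (filter P? xs)) (partsUpTo-≥ (ℕₚ.≰⇒> m≰n)) ⟩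
  genSeries P m (suc n)
    ≡⟨ ℤₚ.+-identityʳ _ ⟨
  genSeries P m (suc n) +ℤ 0ℤ
    ≡⟨ cong (genSeries P m (suc n) +ℤ_) (shift-< _ (ℕₚ.≰⇒> m≰n)) ⟨
  genSeries P m (suc n) +ℤ shift m (genSeries (P ∘ (suc m ∷_)) (suc m)) n ∎
  where
  open ≡-Reasoning
  P? = λ μ → P μ Bool.≟ true

-- Taking the part `suc m` keeps the bound and replaces `P` by what it then demands of the remaining
-- parts. The recursions for odd parts, residue classes and Durfee rectangles are all obtained from
-- this one.
genSeries-suc : ∀ P m → genSeries P (suc m) ≈ genSeries P m ⊕ X (suc m) ⊛ genSeries (P ∘ (suc m ∷_)) (suc m)
genSeries-suc P m = coeffs λ n → trans (genSeries-sucₙ P m n)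
  (sym (trans (⊕-coeff _ _ n) (cong (genSeries P m n +ℤ_) (coeff (X-⊛ (suc m) _) n))))

indicator : Bool → Series
indicator b = if b then 𝟙 else 𝟘

genSeries-0 : ∀ P → genSeries P 0 ≈ indicator (P [])
genSeries-0 P = coeffs λ { zero → at-zero ; (suc n) → at-suc n }
  where
  at-zero : genSeries P 0 0 ≡ indicator (P []) 0
  at-zero with P []
  ... | true  = refl
  ... | false = refl
  firstParts-0 : ∀ xs → filter (_≤? 0) (map suc xs) ≡ []
  firstParts-0 []       = refl
  firstParts-0 (x ∷ xs) = firstParts-0 xs
  at-suc : ∀ n → genSeries P 0 (suc n) ≡ indicator (P []) (suc n)
  at-suc n = trans (cong (λ xs → + length (filter (λ μ → P μ Bool.≟ true) (concatMap (startingWith n n) xs))) (firstParts-0 (upTo (suc n)))) (zeroAt (P []))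
    where
    zeroAt : ∀ b → 0ℤ ≡ indicator b (suc n)
    zeroAt true  = refl
    zeroAt false = refl

genSeries-stable : ∀ P {m m′ n} → n ≤ m → m ≤ m′ → genSeries P m′ n ≡ genSeries P m n
genSeries-stable P {m} {m′} {n} n≤m m≤m′ = go (ℕₚ.≤⇒≤′ m≤m′)
  where
  go : ∀ {m′} → m ℕ.≤′ m′ → genSeries P m′ n ≡ genSeries P m n
  go ℕ.≤′-refl = refl
  go {suc m′} (ℕ.≤′-step m≤m′) = trans (cong (λ xs → + length (filter (λ μ → P μ Bool.≟ true) xs))
    (partsUpTo-≥ (ℕₚ.≤-trans n≤m (ℕₚ.≤′⇒≤ m≤m′)))) (go m≤m′)

infixr 5 _∷_
data Descending : ℕ → List ℕ → Set where
  []  : ∀ {m} → Descending m []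
  _∷_ : ∀ {m j μ} → suc j ≤ m → Descending (suc j) μ → Descending m (suc j ∷ μ)

Descending-weaken : ∀ {m m′ μ} → m ≤ m′ → Descending m μ → Descending m′ μ
Descending-weaken m≤m′ []      = []
Descending-weaken m≤m′ (p ∷ d) = ℕₚ.≤-trans p m≤m′ ∷ d

Descending⇒All≤ : ∀ {m μ} → Descending m μ → All (_≤ m) μ
Descending⇒All≤ []      = []
Descending⇒All≤ (p ∷ d) = p ∷ All.map (λ x≤j → ℕₚ.≤-trans x≤j p) (Descending⇒All≤ d)

-- Agreement is asked only on lists bounded by `m` and descending, so facts about the size of the
-- remaining parts can be used when a property is simplified. The induction is on `n` and then on
-- `m`; the predicates stay quantified because taking a part changes them.
genSeries-cong : ∀ {P Q} m → (∀ {μ} → Descending m μ → P μ ≡ Q μ) → genSeries P m ≈ genSeries Q m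
genSeries-cong m P≡Q = coeffs λ n → <-rec (λ n → ∀ m P Q → (∀ {μ} → Descending m μ → P μ ≡ Q μ) → genSeries P m n ≡ genSeries Q m n) step n m _ _ P≡Q
  where
  step : ∀ n → (∀ {i} → i < n → ∀ m P Q → (∀ {μ} → Descending m μ → P μ ≡ Q μ) → genSeries P m i ≡ genSeries Q m i) →
    ∀ m P Q → (∀ {μ} → Descending m μ → P μ ≡ Q μ) → genSeries P m n ≡ genSeries Q m n
  step n rec zero P Q P≡Q = trans (coeff (genSeries-0 P) n)
    (trans (cong (λ b → indicator b n) (P≡Q [])) (sym (coeff (genSeries-0 Q) n)))
  step n rec (suc m) P Q P≡Q = guarded m n (genSeries-suc P m) (genSeries-suc Q m)
    (step n rec m P Q λ d → P≡Q (Descending-weaken (ℕₚ.n≤1+n m) d))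
    (λ i i<n → rec i<n (suc m) _ _ λ d → P≡Q (ℕₚ.≤-refl ∷ d))

genSeries-false : ∀ m → genSeries (λ _ → false) m ≈ 𝟘
genSeries-false m = coeffs λ n → trans (cong (λ xs → + length xs) (none (partsUpTo n n m))) (sym (𝟘-coeff n))
  where
  none : ∀ xs → filter (λ _ → false Bool.≟ true) xs ≡ []
  none []       = refl
  none (x ∷ xs) = none xs

genSeries-suc′ : ∀ {Q} P m → (∀ μ → P (suc m ∷ μ) ≡ Q μ) → genSeries P (suc m) ≈ genSeries P m ⊕ X (suc m) ⊛ genSeries Q (suc m)
genSeries-suc′ P m eq = ≈-trans (genSeries-suc P m) (⊕-congˡ (⊛-congˡ (genSeries-cong (suc m) λ {μ} _ → eq μ)))

genSeries-skip : ∀ P m → (∀ μ → P (suc m ∷ μ) ≡ false) → genSeries P (suc m) ≈ genSeries P m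
genSeries-skip P m eq = begin
  genSeries P (suc m)                                      ≈⟨ genSeries-suc′ P m eq ⟩
  genSeries P m ⊕ X (suc m) ⊛ genSeries (λ _ → false) (suc m) ≈⟨ ⊕-congˡ (⊛-congˡ (genSeries-false (suc m))) ⟩
  genSeries P m ⊕ X (suc m) ⊛ 𝟘
    ≈⟨ solve 2 (λ f x → f :+ x :* con 0ℤ := f) ≈-refl (genSeries P m) (X (suc m)) ⟩
  genSeries P m ∎
  where open ≈-Reasoning

-- Separating the parts in a residue class from the others

module Split (c : ℕ → Bool) where

  selected : List ℕ → List ℕ
  selected = filter (λ x → c x Bool.≟ true)

  selectedSeries : (List ℕ → Bool) → ℕ → Series
  selectedSeries P = genSeries (λ μ → all c μ ∧ P μ)

  otherSeries : ℕ → Series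
  otherSeries = genSeries (all (not ∘ c))

  selectedSeries-suc : ∀ P m → c (suc m) ≡ true →
    selectedSeries P (suc m) ≈ selectedSeries P m ⊕ X (suc m) ⊛ selectedSeries (P ∘ (suc m ∷_)) (suc m)
  selectedSeries-suc P m eq = genSeries-suc′ _ m λ μ → cong (λ b → (b ∧ all c μ) ∧ P (suc m ∷ μ)) eq

  selectedSeries-skip : ∀ P m → c (suc m) ≡ false → selectedSeries P (suc m) ≈ selectedSeries P m
  selectedSeries-skip P m eq = genSeries-skip _ m λ μ → cong (λ b → (b ∧ all c μ) ∧ P (suc m ∷ μ)) eq

  selected-accept : ∀ {x} → c x ≡ true → ∀ μ → selected (x ∷ μ) ≡ x ∷ selected μ
  selected-accept eq μ = Listₚ.filter-accept (λ x → c x Bool.≟ true) eq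

  selected-reject : ∀ {x} → c x ≡ false → ∀ μ → selected (x ∷ μ) ≡ selected μ
  selected-reject {x} eq μ = Listₚ.filter-reject (λ x → c x Bool.≟ true) {x} {μ} λ eq′ → false≢true (trans (sym eq) eq′)
    where
    false≢true : false ≢ true
    false≢true ()

  -- No bijection on lists is built. The part `suc m` belongs to exactly one class, so only one of
  -- the two factors changes with the bound, and the product obeys the recursion of the left side.
  factor : ∀ P m → genSeries (P ∘ selected) m ≈ otherSeries m ⊛ selectedSeries P m
  factor P m = coeffs λ n → <-rec (λ n → ∀ m P → genSeries (P ∘ selected) m n ≡ (otherSeries m ⊛ selectedSeries P m) n) step n m P
    where
    step : ∀ n → (∀ {i} → i < n → ∀ m P → genSeries (P ∘ selected) m i ≡ (otherSeries m ⊛ selectedSeries P m) i) →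
      ∀ m P → genSeries (P ∘ selected) m n ≡ (otherSeries m ⊛ selectedSeries P m) n
    step n rec zero P = coeff (≈-trans (genSeries-0 (P ∘ selected))
      (≈-sym (≈-trans (⊛-cong (genSeries-0 (all (not ∘ c))) (genSeries-0 (λ μ → all c μ ∧ P μ))) (𝟙-⊛ (indicator (P []))))))  n
    step n rec (suc m) P with c (suc m) in eq
    ... | true = guarded m n
      (genSeries-suc′ (P ∘ selected) m λ μ → cong P (selected-accept eq μ))
      (≈-trans (⊛-cong (genSeries-skip _ m λ μ → cong (λ b → not b ∧ all (not ∘ c) μ) eq) (selectedSeries-suc P m eq))
        (≈-trans (solve 4 (λ o f x g → o :* (f :+ x :* g) := o :* f :+ x :* (o :* g)) ≈-refl
          (otherSeries m) (selectedSeries P m) (X (suc m)) (selectedSeries (P ∘ (suc m ∷_)) (suc m)))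
        (⊕-congˡ (⊛-congˡ (⊛-congʳ (≈-sym (genSeries-skip _ m λ μ → cong (λ b → not b ∧ all (not ∘ c) μ) eq)))))))
      (step n rec m P)
      (λ i i<n → rec i<n (suc m) (P ∘ (suc m ∷_)))
    ... | false = guarded m n
      (genSeries-suc′ (P ∘ selected) m λ μ → cong P (selected-reject eq μ))
      (≈-trans (⊛-cong (genSeries-suc′ _ m λ μ → cong (λ b → not b ∧ all (not ∘ c) μ) eq) (selectedSeries-skip P m eq))
        (≈-trans (solve 4 (λ o f x g → (o :+ x :* g) :* f := o :* f :+ x :* (g :* f)) ≈-refl
          (otherSeries m) (selectedSeries P m) (X (suc m)) (otherSeries (suc m)))
        (⊕-congˡ (⊛-congˡ (⊛-congˡ (≈-sym (selectedSeries-skip P m eq)))))))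
      (step n rec m P)
      (λ i i<n → rec i<n (suc m) P)

⌊⌋-true : ∀ {A : Set} (a? : Dec A) → A → ⌊ a? ⌋ ≡ true
⌊⌋-true a? p = trans (isYes≗does a?) (dec-true a? p)

⌊⌋-false : ∀ {A : Set} (a? : Dec A) → ¬ A → ⌊ a? ⌋ ≡ false
⌊⌋-false a? ¬p = trans (isYes≗does a?) (dec-false a? ¬p)

%-distinct : ∀ x i m′ → suc i ≤ m′ → (x + suc i) % suc m′ ≢ x % suc m′
%-distinct x i m′ i<m′ eq = ℕₚ.<⇒≱ (s≤s i<m′) (∣⇒≤ (∣m+n∣m⇒∣n (divides q′ multiple) (divides q refl)))
  where
  m = suc m′
  q = x / m
  q′ = (x + suc i) / m
  multiple : q * m + suc i ≡ q′ * m
  multiple = ℕₚ.+-cancelˡ-≡ (x % m) _ _ (begin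
    x % m + (q * m + suc i)       ≡⟨ ℕₚ.+-assoc (x % m) (q * m) (suc i) ⟨
    x % m + q * m + suc i         ≡⟨ cong (_+ suc i) (m≡m%n+[m/n]*n x m) ⟨
    x + suc i                     ≡⟨ m≡m%n+[m/n]*n (x + suc i) m ⟩
    (x + suc i) % m + q′ * m      ≡⟨ cong (_+ q′ * m) eq ⟩
    x % m + q′ * m ∎)
    where open ≡-Reasoning

module Residue (a′ m′ : ℕ) where

  a m : ℕ
  a = suc a′
  m = suc m′

  part : ℕ → ℕ
  part j = a + m * j

  open Split (congA a m) public

  part-% : ∀ L → part L % m ≡ a % m
  part-% L = trans (cong (λ k → (a + k) % m) (ℕₚ.*-comm m L)) ([m+kn]%n≡m%n a L m)

  congA-part : ∀ L → congA a m (part L) ≡ true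
  congA-part L = ⌊⌋-true (part L % m ≟ a % m) (part-% L)

  congA-between : ∀ L i → i < m′ → congA a m (suc (part L + i)) ≡ false
  congA-between L i i<m′ = ⌊⌋-false (suc (part L + i) % m ≟ a % m) λ eq →
    %-distinct (part L) i m′ i<m′ (trans (cong (_% m) (ℕₚ.+-suc (part L) i)) (trans eq (sym (part-% L))))

  -- Partitions into the L smallest parts a, a + m, …, a + m (L - 1).
  levelSeries : (List ℕ → Bool) → ℕ → Series
  levelSeries P L = selectedSeries P (a′ + m * L)

  above : ∀ P L i → i ≤ m′ → selectedSeries P (part L + i) ≈ selectedSeries P (part L)
  above P L zero    _    = ≡⇒≈ (cong (selectedSeries P) (ℕₚ.+-identityʳ (part L)))
  above P L (suc i) i<m′ = ≈-trans (≡⇒≈ (cong (selectedSeries P) (ℕₚ.+-suc (part L) i)))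
    (≈-trans (selectedSeries-skip P (part L + i) (congA-between L i i<m′)) (above P L i (ℕₚ.<⇒≤ i<m′)))

  levelSeries-part : ∀ P L → levelSeries P (suc L) ≈ selectedSeries P (part L)
  levelSeries-part P L = ≈-trans (≡⇒≈ (cong (selectedSeries P) (next a′ m′ L))) (above P L m′ ℕₚ.≤-refl)
    where
    next : ∀ a′ m′ L → a′ + suc m′ * suc L ≡ suc a′ + suc m′ * L + m′
    next = solve-∀

  -- From one level to the next the bound rises by `m`, but among the new parts only `part L` lies
  -- in the residue class, so the `m` steps collapse into one.
  levelSeries-suc : ∀ P L → levelSeries P (suc L) ≈ levelSeries P L ⊕ X (part L) ⊛ levelSeries (P ∘ (part L ∷_)) (suc L)
  levelSeries-suc P L = begin
    levelSeries P (suc L)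
      ≈⟨ levelSeries-part P L ⟩
    selectedSeries P (part L)
      ≈⟨ selectedSeries-suc P (a′ + m * L) (congA-part L) ⟩
    levelSeries P L ⊕ X (part L) ⊛ selectedSeries (P ∘ (part L ∷_)) (part L)
      ≈⟨ ⊕-congˡ (⊛-congˡ (levelSeries-part (P ∘ (part L ∷_)) L)) ⟨
    levelSeries P L ⊕ X (part L) ⊛ levelSeries (P ∘ (part L ∷_)) (suc L) ∎
    where open ≈-Reasoning

  levelSeries-cong : ∀ {P Q} L → (∀ {μ} → Descending (a′ + m * L) μ → P μ ≡ Q μ) → levelSeries P L ≈ levelSeries Q L
  levelSeries-cong L eq = genSeries-cong (a′ + m * L) λ {μ} d → cong (all (congA a m) μ ∧_) (eq d)

  levelSeries-false : ∀ L → levelSeries (λ _ → false) L ≈ 𝟘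
  levelSeries-false L = ≈-trans (genSeries-cong (a′ + m * L) λ {μ} _ → ∧-zeroʳ (all (congA a m) μ)) (genSeries-false (a′ + m * L))

-- The Durfee rectangle of a list of row lengths

all-++ : ∀ {A : Set} (P : A → Bool) xs ys → all P (xs ++ ys) ≡ all P xs ∧ all P ys
all-++ P []       ys = refl
all-++ P (x ∷ xs) ys = trans (cong (P x ∧_) (all-++ P xs ys)) (sym (∧-assoc (P x) (all P xs) (all P ys)))

any-++ : ∀ {A : Set} (P : A → Bool) xs ys → any P (xs ++ ys) ≡ any P xs ∨ any P ys
any-++ P []       ys = refl
any-++ P (x ∷ xs) ys = trans (cong (P x ∨_) (any-++ P xs ys)) (sym (∨-assoc (P x) (any P xs) (any P ys)))

all-true : ∀ {A : Set} {P : A → Bool} {xs} → All (λ x → P x ≡ true) xs → all P xs ≡ true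
all-true []       = refl
all-true (p ∷ ps) = cong₂ _∧_ p (all-true ps)

any-false : ∀ {A : Set} {P : A → Bool} {xs} → All (λ x → P x ≡ false) xs → any P xs ≡ false
any-false []       = refl
any-false (p ∷ ps) = cong₂ _∨_ p (any-false ps)

-- The numbering of `rows`, with `i` rows already passed, in a form that splits along `++`.
numbered : ℕ → List ℕ → List (ℕ × ℕ)
numbered i []       = []
numbered i (x ∷ xs) = (suc i , x) ∷ numbered (suc i) xs

numbered-++ : ∀ i xs ys → numbered i (xs ++ ys) ≡ numbered i xs ++ numbered (i + length xs) ys
numbered-++ i []       ys = cong (λ k → numbered k ys) (sym (ℕₚ.+-identityʳ i))
numbered-++ i (x ∷ xs) ys = cong ((suc i , x) ∷_) (trans (numbered-++ (suc i) xs ys)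
  (cong (λ k → numbered (suc i) xs ++ numbered k ys) (sym (ℕₚ.+-suc i (length xs)))))

zip-numbered : ∀ (f : ℕ → ℕ) i xs → (∀ k → f k ≡ suc (i + k)) → zip (applyUpTo f (length xs)) xs ≡ numbered i xs
zip-numbered f i []       eq = refl
zip-numbered f i (x ∷ xs) eq = cong₂ (λ k rs → (k , x) ∷ rs) (trans (eq 0) (cong suc (ℕₚ.+-identityʳ i)))
  (zip-numbered (f ∘ suc) (suc i) xs λ k → trans (eq (suc k)) (cong suc (ℕₚ.+-suc i k)))

module Height (ν : ℕ) where

  high? : (r : ℕ × ℕ) → Dec (proj₁ r + ν + 2 ≤ proj₂ r)
  high? r = proj₁ r + ν + 2 ≤? proj₂ r

  filter-low : ∀ i qs → All (_≤ i + ν + 2) qs → filter high? (numbered i qs) ≡ []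
  filter-low i []       []       = refl
  filter-low i (q ∷ qs) (p ∷ ps) = trans (Listₚ.filter-reject high? {suc i , q} {numbered (suc i) qs} (ℕₚ.<⇒≱ (s≤s p)))
    (filter-low (suc i) qs (All.map ℕₚ.m≤n⇒m≤1+n ps))

  filter-high : ∀ i ps → All (i + length ps + ν + 2 ≤_) ps → filter high? (numbered i ps) ≡ numbered i ps
  filter-high i []       []       = refl
  filter-high i (p ∷ ps) (h ∷ hs) = trans
    (Listₚ.filter-accept high? (ℕₚ.≤-trans (ℕₚ.+-monoˡ-≤ 2 (ℕₚ.+-monoˡ-≤ ν (ℕₚ.m≤m+n (suc i) (length ps)))) (subst (λ k → k + ν + 2 ≤ p) (ℕₚ.+-suc i (length ps)) h)))
    (cong ((suc i , p) ∷_) (filter-high (suc i) ps (subst (λ k → All (k + ν + 2 ≤_) ps) (ℕₚ.+-suc i (length ps)) hs)))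

  -- The maximum with `i` covers the empty list, where the fold gives 0.
  numbered-max : ∀ i ps → i ⊔ foldr _⊔_ 0 (map proj₁ (numbered i ps)) ≡ i + length ps
  numbered-max i []       = trans (ℕₚ.⊔-identityʳ i) (sym (ℕₚ.+-identityʳ i))
  numbered-max i (p ∷ ps) = begin
    i ⊔ (suc i ⊔ foldr _⊔_ 0 (map proj₁ (numbered (suc i) ps))) ≡⟨ cong (i ⊔_) (numbered-max (suc i) ps) ⟩
    i ⊔ (suc i + length ps) ≡⟨ ℕₚ.m≤n⇒m⊔n≡n (ℕₚ.m≤n⇒m≤1+n (ℕₚ.m≤m+n i (length ps))) ⟩
    suc i + length ps       ≡⟨ ℕₚ.+-suc i (length ps) ⟨
    i + suc (length ps) ∎
    where open ≡-Reasoning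

  height : List (ℕ × ℕ) → ℕ
  height rs = foldr _⊔_ 0 (map proj₁ (filter high? rs))

  -- A row of `qs` may have exactly `length ps + ν + 2` boxes: its index is at least
  -- `length ps + 1`, so it would need one box more to enlarge the rectangle.
  height-≡ : ∀ ps qs → All (length ps + ν + 2 ≤_) ps → All (_≤ length ps + ν + 2) qs →
    height (numbered 0 (ps ++ qs)) ≡ length ps
  height-≡ ps qs hs ls = trans (cong (λ rs → foldr _⊔_ 0 (map proj₁ rs)) (begin
    filter high? (numbered 0 (ps ++ qs))
      ≡⟨ cong (filter high?) (numbered-++ 0 ps qs) ⟩
    filter high? (numbered 0 ps ++ numbered (length ps) qs)
      ≡⟨ Listₚ.filter-++ high? (numbered 0 ps) _ ⟩
    filter high? (numbered 0 ps) ++ filter high? (numbered (length ps) qs)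
      ≡⟨ cong₂ _++_ (filter-high 0 ps hs) (filter-low (length ps) qs ls) ⟩
    numbered 0 ps ++ []                                                     ≡⟨ Listₚ.++-identityʳ _ ⟩
    numbered 0 ps ∎)) (numbered-max 0 ps)
    where open ≡-Reasoning

  narrow : ℕ → ℕ × ℕ → Bool
  narrow t r = not ⌊ t <? proj₁ r ⌋ ∨ ⌊ proj₂ r <? t + ν + 2 ⌋

  narrow-before : ∀ t i ps → i + length ps ≤ t → all (narrow t) (numbered i ps) ≡ true
  narrow-before t i []       _ = refl
  narrow-before t i (p ∷ ps) i+l≤t = cong₂ _∧_
    (cong (λ b → not b ∨ ⌊ p <? t + ν + 2 ⌋) (⌊⌋-false (t <? suc i) (ℕₚ.≤⇒≯ (ℕₚ.≤-trans (ℕₚ.m≤m+n (suc i) (length ps)) bound))))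
    (narrow-before t (suc i) ps bound)
    where
    bound : suc i + length ps ≤ t
    bound = subst (_≤ t) (ℕₚ.+-suc i (length ps)) i+l≤t

  narrow-after : ∀ t i qs → t ≤ i → all (narrow t) (numbered i qs) ≡ all (λ q → ⌊ q <? t + ν + 2 ⌋) qs
  narrow-after t i []       _   = refl
  narrow-after t i (q ∷ qs) t≤i = cong₂ _∧_
    (cong (λ b → not b ∨ ⌊ q <? t + ν + 2 ⌋) (⌊⌋-true (t <? suc i) (s≤s t≤i)))
    (narrow-after t (suc i) qs (ℕₚ.m≤n⇒m≤1+n t≤i))

  -- Rows up to the height are exempt. Those after it are already at most as wide as the rectangle,
  -- so the condition merely excludes equality.
  narrow-height : ∀ ps qs → All (length ps + ν + 2 ≤_) ps → All (_≤ length ps + ν + 2) qs →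
    all (narrow (height (numbered 0 (ps ++ qs)))) (numbered 0 (ps ++ qs)) ≡ all (λ q → ⌊ q <? length ps + ν + 2 ⌋) qs
  narrow-height ps qs hs ls = begin
    all (narrow (height (numbered 0 (ps ++ qs)))) (numbered 0 (ps ++ qs))
      ≡⟨ cong₂ (λ t rs → all (narrow t) rs) (height-≡ ps qs hs ls) (numbered-++ 0 ps qs) ⟩
    all (narrow c) (numbered 0 ps ++ numbered c qs)
      ≡⟨ all-++ (narrow c) (numbered 0 ps) (numbered c qs) ⟩
    all (narrow c) (numbered 0 ps) ∧ all (narrow c) (numbered c qs)
      ≡⟨ cong₂ _∧_ (narrow-before c 0 ps ℕₚ.≤-refl) (narrow-after c c qs ℕₚ.≤-refl) ⟩
    all (λ q → ⌊ q <? c + ν + 2 ⌋) qs ∎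
    where
    open ≡-Reasoning
    c = length ps

-- The recursion behind M(a,m,ν;n)

module Durfee (a′ m′ : ℕ) where

  open Residue a′ m′ public

  occurs : ℕ → List ℕ → Bool
  occurs j = any (λ x → ⌊ x ≟ part j ⌋)

  containsFirst : ℕ → List ℕ → Bool
  containsFirst k μ = all (λ j → occurs j μ) (upTo k)

  containsFirst-suc : ∀ k μ → containsFirst (suc k) μ ≡ containsFirst k μ ∧ occurs k μ
  containsFirst-suc k μ = begin
    containsFirst (suc k) μ                       ≡⟨ cong (all (λ j → occurs j μ)) (sym (Listₚ.upTo-∷ʳ k)) ⟩
    all (λ j → occurs j μ) (upTo k ++ [ k ])      ≡⟨ all-++ (λ j → occurs j μ) (upTo k) [ k ] ⟩
    containsFirst k μ ∧ (occurs k μ ∧ true)       ≡⟨ cong (containsFirst k μ ∧_) (∧-identityʳ (occurs k μ)) ⟩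
    containsFirst k μ ∧ occurs k μ ∎
    where open ≡-Reasoning

  containsFirst-++ : ∀ k pre μ → (∀ j → j < k → All (_≢ part j) pre) → containsFirst k (pre ++ μ) ≡ containsFirst k μ
  containsFirst-++ zero    pre μ _      = refl
  containsFirst-++ (suc k) pre μ absent = begin
    containsFirst (suc k) (pre ++ μ)                     ≡⟨ containsFirst-suc k (pre ++ μ) ⟩
    containsFirst k (pre ++ μ) ∧ occurs k (pre ++ μ)
      ≡⟨ cong₂ _∧_ (containsFirst-++ k pre μ λ j j<k → absent j (ℕₚ.m≤n⇒m≤1+n j<k)) (any-++ _ pre μ) ⟩
    containsFirst k μ ∧ (occurs k pre ∨ occurs k μ)
      ≡⟨ cong (λ b → containsFirst k μ ∧ (b ∨ occurs k μ)) (any-false (All.map (⌊⌋-false (_ ≟ _)) (absent k ℕₚ.≤-refl))) ⟩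
    containsFirst k μ ∧ occurs k μ                       ≡⟨ containsFirst-suc k μ ⟨
    containsFirst (suc k) μ ∎
    where open ≡-Reasoning

  part-mono-< : ∀ {i j} → i < j → part i < part j
  part-mono-< i<j = ℕₚ.+-monoʳ-< a (ℕₚ.*-monoʳ-< m i<j)

  small : ℕ → Series
  small = levelSeries (λ _ → true)

  small-suc : ∀ L → small (suc L) ≈ small L ⊕ X (part L) ⊛ small (suc L)
  small-suc = levelSeries-suc (λ _ → true)

  partSum : ℕ → ℕ
  partSum zero    = 0
  partSum (suc k) = part k + partSum k

  -- Removing one copy of each required part leaves an arbitrary partition. Here this is read off
  -- level by level instead of by a map on lists.
  containsFirst-series : ∀ k L → k ≤ L → levelSeries (containsFirst k) L ≈ X (partSum k) ⊛ small L
  containsFirst-series zero    L       _         = ≈-sym (𝟙-⊛ (small L))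
  containsFirst-series (suc k) (suc L) (s≤s k≤L) with ℕₚ.m≤n⇒m<n∨m≡n k≤L
  -- The top part is not among the required ones, so both sides solve the same equation f = f₀ + X
  -- f.
  ... | inj₁ k<L = guarded-unique (a′ + m * L)
    (≈-trans (levelSeries-suc (containsFirst (suc k)) L)
      (⊕-congˡ (⊛-congˡ (levelSeries-cong (suc L) λ {μ} _ → containsFirst-++ (suc k) [ part L ] μ
        λ j j≤k → (ℕₚ.>⇒≢ (part-mono-< (ℕₚ.<-≤-trans j≤k k<L))) ∷ []))))
    (≈-trans (⊛-congˡ (small-suc L))
      (solve 4 (λ t s x s′ → t :* (s :+ x :* s′) := t :* s :+ x :* (t :* s′)) ≈-refl
        (X (partSum (suc k))) (small L) (X (part L)) (small (suc L))))
    (containsFirst-series (suc k) L k<L)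
  -- The top part is itself required: nothing remains without it, and after one copy only the `k`
  -- smaller parts are still required.
  ... | inj₂ refl = begin
    levelSeries (containsFirst (suc k)) (suc k)
      ≈⟨ levelSeries-suc (containsFirst (suc k)) k ⟩
    levelSeries (containsFirst (suc k)) k ⊕ X (part k) ⊛ levelSeries (containsFirst (suc k) ∘ (part k ∷_)) (suc k)
      ≈⟨ ⊕-cong (≈-trans (levelSeries-cong k λ {μ} d → missing μ d) (levelSeries-false k))
           (⊛-congˡ (≈-trans (levelSeries-cong (suc k) λ {μ} _ → present μ) (containsFirst-series k (suc k) (ℕₚ.n≤1+n k)))) ⟩
    𝟘 ⊕ X (part k) ⊛ (X (partSum k) ⊛ small (suc k))
      ≈⟨ solve 3 (λ x t s → con 0ℤ :+ x :* (t :* s) := x :* t :* s)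
           ≈-refl (X (part k)) (X (partSum k)) (small (suc k)) ⟩
    X (part k) ⊛ X (partSum k) ⊛ small (suc k)
      ≈⟨ ⊛-congʳ (X-+ (part k) (partSum k)) ⟨
    X (partSum (suc k)) ⊛ small (suc k) ∎
    where
    open ≈-Reasoning
    missing : ∀ μ → Descending (a′ + m * k) μ → containsFirst (suc k) μ ≡ false
    missing μ d = trans (containsFirst-suc k μ) (trans (cong (containsFirst k μ ∧_)
      (any-false (All.map (λ x≤ → ⌊⌋-false (_ ≟ _) (ℕₚ.<⇒≢ (s≤s x≤))) (Descending⇒All≤ d)))) (∧-zeroʳ (containsFirst k μ)))
    present : ∀ μ → containsFirst (suc k) (part k ∷ μ) ≡ containsFirst k μ
    present μ = trans (containsFirst-suc k (part k ∷ μ)) (trans (cong₂ _∧_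
      (containsFirst-++ k [ part k ] μ λ j j<k → ℕₚ.>⇒≢ (part-mono-< j<k) ∷ [])
      (cong (_∨ occurs k μ) (⌊⌋-true (part k ≟ part k) refl))) (∧-identityʳ (containsFirst k μ)))

  -- Ways to complete c chosen parts with ℓ ≥ suc r + c + e by parts with ℓ ≤ suc r + c + e so that
  -- the condition on the (suc r)-Durfee rectangle holds.  A step forbids the largest remaining part
  -- or chooses one more copy of it; at e = 0 the rectangle has height c.
  durfee : ℕ → ℕ → ℕ → Series
  durfee r c zero    = small (r + c)
  durfee r c (suc e) = durfee r c e ⊕ X (part (suc r + c + e)) ⊛ durfee r (suc c) e

  part-+ : ∀ r c → part (r + c) ≡ part r + m * c
  part-+ r c = trans (cong (λ k → a + k) (ℕₚ.*-distribˡ-+ m r c)) (sym (ℕₚ.+-assoc a (m * r) (m * c)))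

  -- Shifting the c chosen parts by m turns the recursion for suc r into the one for r.
  durfee-complement : ∀ r c e → durfee r c e ⊕ X (part r + m * c) ⊛ durfee (suc r) c e ≈ small (suc r + c + e)
  durfee-complement r c zero = begin
    small (r + c) ⊕ X (part r + m * c) ⊛ small (suc (r + c))
      ≡⟨ cong (λ k → small (r + c) ⊕ X k ⊛ small (suc (r + c))) (part-+ r c) ⟨
    -- The offset is exactly one copy of `part (r + c)`: the two summands are the partitions without
    -- and with that part.
    small (r + c) ⊕ X (part (r + c)) ⊛ small (suc (r + c))
      ≈⟨ small-suc (r + c) ⟨
    small (suc r + c)
      ≡⟨ cong small (ℕₚ.+-identityʳ (suc r + c)) ⟨
    small (suc r + c + 0) ∎
    where open ≈-Reasoning
  durfee-complement r c (suc e) = begin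
    d ⊕ X u ⊛ d⁺ ⊕ X q ⊛ (d′ ⊕ X u′ ⊛ d′⁺)
      ≈⟨ solve 7 (λ d x d⁺ y d′ x′ d′⁺ → d :+ x :* d⁺ :+ y :* (d′ :+ x′ :* d′⁺) := (d :+ y :* d′) :+ (x :* d⁺ :+ (y :* x′) :* d′⁺))
           ≈-refl d (X u) d⁺ (X q) d′ (X u′) d′⁺ ⟩
    (d ⊕ X q ⊛ d′) ⊕ (X u ⊛ d⁺ ⊕ (X q ⊛ X u′) ⊛ d′⁺)
      -- Since u′ = u + m and q⁺ = q + m, the excess `m` of the newly chosen part moves into the
      -- offset, where `c` becomes `suc c`.
      ≈⟨ ⊕-congˡ (⊕-congˡ (⊛-congʳ exchange)) ⟩
    (d ⊕ X q ⊛ d′) ⊕ (X u ⊛ d⁺ ⊕ (X u ⊛ X q⁺) ⊛ d′⁺)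
      ≈⟨ ⊕-congˡ (solve 4 (λ x d⁺ y d′⁺ → x :* d⁺ :+ x :* y :* d′⁺ := x :* (d⁺ :+ y :* d′⁺))
           ≈-refl (X u) d⁺ (X q⁺) d′⁺) ⟩
    (d ⊕ X q ⊛ d′) ⊕ X u ⊛ (d⁺ ⊕ X q⁺ ⊛ d′⁺)
      ≈⟨ ⊕-cong (durfee-complement r c e) (⊛-congˡ (durfee-complement r (suc c) e)) ⟩
    small (suc r + c + e) ⊕ X u ⊛ small (suc r + suc c + e)
      ≡⟨ cong (λ k → small (suc r + c + e) ⊕ X u ⊛ small (k + e)) (ℕₚ.+-suc (suc r) c) ⟩
    small (suc r + c + e) ⊕ X u ⊛ small (suc (suc r + c + e))
      ≈⟨ small-suc (suc r + c + e) ⟨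
    small (suc (suc r + c + e))
      ≡⟨ cong small (ℕₚ.+-suc (suc r + c) e) ⟨
    small (suc r + c + suc e) ∎
    where
    open ≈-Reasoning
    d = durfee r c e
    d⁺ = durfee r (suc c) e
    d′ = durfee (suc r) c e
    d′⁺ = durfee (suc r) (suc c) e
    u = part (suc r + c + e)
    u′ = part (suc (suc r) + c + e)
    q = part r + m * c
    q⁺ = part r + m * suc c
    exchangeℕ : ∀ a m r c e → (a + m * r + m * c) + (a + m * (suc (suc r) + c + e)) ≡ (a + m * (suc r + c + e)) + (a + m * r + m * suc c)
    exchangeℕ = solve-∀
    exchange : X q ⊛ X u′ ≈ X u ⊛ X q⁺
    exchange = ≈-trans (≈-sym (X-+ q u′)) (≈-trans (≡⇒≈ (cong X (exchangeℕ a m r c e))) (X-+ u q⁺))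

  ell-part : ∀ L → ell a m (part L) ≡ suc L
  ell-part L = cong suc (trans (cong (_/ m) (trans (ℕₚ.m+n∸m≡n a (m * L)) (ℕₚ.*-comm m L))) (m*n/n≡m L m))

  ell-≤ : ∀ L {x} → x ≤ a′ + m * suc L → ell a m x ≤ suc L
  ell-≤ L {x} x≤ = m<n*o⇒m/o<n {n = suc L} (subst (x ∸ a <_) (ℕₚ.*-comm m (suc L)) (ℕₚ.m<n+o⇒m∸n<o x a (s≤s x≤)))

  rows-numbered : ∀ μ → rows a m μ ≡ numbered 0 (map (ell a m) μ)
  rows-numbered μ = begin
    zip (map suc (upTo (length μ))) ells
      ≡⟨ cong₂ (λ ks l → zip ks l) (Listₚ.map-upTo suc (length μ)) refl ⟩
    zip (applyUpTo suc (length μ)) ells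
      ≡⟨ cong (λ k → zip (applyUpTo suc k) ells) (sym (Listₚ.length-map (ell a m) μ)) ⟩
    zip (applyUpTo suc (length ells)) ells            ≡⟨ zip-numbered suc 0 ells (λ _ → refl) ⟩
    numbered 0 ells ∎
    where
    open ≡-Reasoning
    ells = map (ell a m) μ

  module _ (ν : ℕ) where

    open Height ν

    -- A required part has at most `suc ν` boxes and those in `pre` have more, so occurrence is
    -- decided by `μ` alone; the width condition passes to `μ` because `pre` fills the height of the
    -- rectangle.
    isM-split : ∀ pre μ → let c = length pre in
      All (λ x → suc (suc ν) + c ≤ ell a m x) pre → All (λ x → ell a m x ≤ suc (suc ν) + c) μ →
      isM a m ν (pre ++ μ) ≡ containsFirst (suc ν) μ ∧ all (λ q → ⌊ q <? suc (suc ν) + c ⌋) (map (ell a m) μ)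
    isM-split pre μ hs ls = cong₂ _∧_
      (containsFirst-++ (suc ν) pre μ λ j j≤ν → All.map (λ h eq → ℕₚ.<⇒≱ (s≤s j≤ν)
        (ℕₚ.≤-trans (ℕₚ.m≤m+n (suc (suc ν)) c) (subst (suc (suc ν) + c ≤_) (trans (cong (ell a m) eq) (ell-part j)) h))) hs)
      (begin
        all (narrow (height (rows a m (pre ++ μ)))) (rows a m (pre ++ μ))
          ≡⟨ cong (λ rs → all (narrow (height rs)) rs) (trans (rows-numbered (pre ++ μ)) (cong (numbered 0) (Listₚ.map-++ (ell a m) pre μ))) ⟩
        all (narrow (height (numbered 0 (ps ++ qs)))) (numbered 0 (ps ++ qs))
          ≡⟨ narrow-height ps qs
               (Allₚ.map⁺ (All.map (λ {x} h → subst (_≤ ell a m x) (sym width) h) hs))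
               (Allₚ.map⁺ (All.map (λ {x} l → subst (ell a m x ≤_) (sym width) l) ls)) ⟩
        all (λ q → ⌊ q <? length ps + ν + 2 ⌋) qs
          ≡⟨ cong (λ k → all (λ q → ⌊ q <? k ⌋) qs) width ⟩
        all (λ q → ⌊ q <? suc (suc ν) + c ⌋) qs ∎)
      where
      open ≡-Reasoning
      c = length pre
      ps = map (ell a m) pre
      qs = map (ell a m) μ
      reorder : ∀ c ν → c + ν + 2 ≡ suc (suc ν) + c
      reorder = solve-∀
      width : length ps + ν + 2 ≡ suc (suc ν) + c
      width = trans (cong (λ k → k + ν + 2) (Listₚ.length-map (ell a m) pre)) (reorder c ν)

    -- The chosen parts matter only through their number. Both choices, forbidding the top part or
    -- taking it once more, lower `e`, the distance from the moment when the height is known.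
    isM-series : ∀ e pre → let c = length pre in All (λ x → suc (suc ν) + c + e ≤ ell a m x) pre →
      levelSeries (λ μ → isM a m ν (pre ++ μ)) (suc (suc ν) + c + e) ≈ X (partSum (suc ν)) ⊛ durfee (suc ν) c e
    isM-series zero pre hs = begin
      levelSeries (λ μ → isM a m ν (pre ++ μ)) (suc (suc ν) + c + 0)
        ≡⟨ cong (levelSeries (λ μ → isM a m ν (pre ++ μ))) (ℕₚ.+-identityʳ (suc (suc ν) + c)) ⟩
      levelSeries (λ μ → isM a m ν (pre ++ μ)) (suc L)
        ≈⟨ levelSeries-cong (suc L) (λ {μ} d → isM-split pre μ
             (All.map (λ {x} h → subst (_≤ ell a m x) (ℕₚ.+-identityʳ (suc (suc ν) + c)) h) hs) (All.map (ell-≤ L) (Descending⇒All≤ d))) ⟩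
      levelSeries Q (suc L)
        ≈⟨ levelSeries-suc Q L ⟩
      levelSeries Q L ⊕ X (part L) ⊛ levelSeries (Q ∘ (part L ∷_)) (suc L)
        -- `part L` has `suc L` boxes, exactly the excluded width; for smaller parts the width
        -- condition is automatic.
        ≈⟨ ⊕-cong (levelSeries-cong L λ {μ} d → trans (cong (containsFirst (suc ν) μ ∧_) (narrowed d)) (∧-identityʳ _))
             (⊛-congˡ (≈-trans (levelSeries-cong (suc L) λ {μ} _ → cornered μ) (levelSeries-false (suc L)))) ⟩
      levelSeries (containsFirst (suc ν)) L ⊕ X (part L) ⊛ 𝟘
        ≈⟨ solve 2 (λ f x → f :+ x :* con 0ℤ := f) ≈-refl _ (X (part L)) ⟩
      levelSeries (containsFirst (suc ν)) L
        ≈⟨ containsFirst-series (suc ν) L (ℕₚ.m≤m+n (suc ν) c) ⟩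
      X (partSum (suc ν)) ⊛ small L ∎
      where
      open ≈-Reasoning
      c = length pre
      L = suc ν + c
      Q : List ℕ → Bool
      Q μ = containsFirst (suc ν) μ ∧ all (λ q → ⌊ q <? suc L ⌋) (map (ell a m) μ)
      narrowed : ∀ {μ} → Descending (a′ + m * L) μ → all (λ q → ⌊ q <? suc L ⌋) (map (ell a m) μ) ≡ true
      narrowed d = all-true (Allₚ.map⁺ (All.map (λ x≤ → ⌊⌋-true (_ <? suc L) (s≤s (ell-≤ (ν + c) x≤))) (Descending⇒All≤ d)))
      cornered : ∀ μ → Q (part L ∷ μ) ≡ false
      cornered μ = trans (cong (λ b → containsFirst (suc ν) (part L ∷ μ) ∧ (b ∧ all (λ q → ⌊ q <? suc L ⌋) (map (ell a m) μ)))
        (⌊⌋-false (_ <? suc L) (ℕₚ.≤⇒≯ (ℕₚ.≤-reflexive (sym (ell-part L)))))) (∧-zeroʳ _)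
    isM-series (suc e) pre hs = begin
      levelSeries P (suc (suc ν) + c + suc e)
        ≡⟨ cong (levelSeries P) (ℕₚ.+-suc (suc (suc ν) + c) e) ⟩
      levelSeries P (suc L)
        ≈⟨ levelSeries-suc P L ⟩
      levelSeries P L ⊕ X (part L) ⊛ levelSeries (P ∘ (part L ∷_)) (suc L)
        ≈⟨ ⊕-cong (isM-series e pre (All.map (λ {x} h → ℕₚ.≤-trans (ℕₚ.n≤1+n L) (subst (_≤ ell a m x) (ℕₚ.+-suc (suc (suc ν) + c) e) h)) hs))
             (⊛-congˡ extended) ⟩
      X t ⊛ durfee (suc ν) c e ⊕ X (part L) ⊛ (X t ⊛ durfee (suc ν) (suc c) e)
        ≈⟨ solve 4 (λ t d x d′ → t :* d :+ x :* (t :* d′) := t :* (d :+ x :* d′))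
             ≈-refl (X t) (durfee (suc ν) c e) (X (part L)) (durfee (suc ν) (suc c) e) ⟩
      X t ⊛ durfee (suc ν) c (suc e) ∎
      where
      open ≈-Reasoning
      c = length pre
      L = suc (suc ν) + c + e
      t = partSum (suc ν)
      P : List ℕ → Bool
      P μ = isM a m ν (pre ++ μ)
      -- Parts arrive in descending order, so the new one goes to the end. As `c` rises and `e`
      -- falls by one, the level is unchanged and the same part may be taken again.
      pre⁺ = pre ++ [ part L ]
      length⁺ : length pre⁺ ≡ suc c
      length⁺ = trans (Listₚ.length-++ pre) (ℕₚ.+-comm c 1)
      level⁺ : suc (suc ν) + length pre⁺ + e ≡ suc L
      level⁺ = trans (cong (λ k → suc (suc ν) + k + e) length⁺) (cong (λ k → k + e) (ℕₚ.+-suc (suc (suc ν)) c))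
      hs⁺ : All (λ x → suc (suc ν) + length pre⁺ + e ≤ ell a m x) pre⁺
      hs⁺ = Allₚ.++⁺ (All.map (λ {x} h → subst (_≤ ell a m x) (trans (ℕₚ.+-suc (suc (suc ν) + c) e) (sym level⁺)) h) hs)
        (subst (suc (suc ν) + length pre⁺ + e ≤_) (sym (ell-part L)) (ℕₚ.≤-reflexive level⁺) ∷ [])
      extended : levelSeries (P ∘ (part L ∷_)) (suc L) ≈ X t ⊛ durfee (suc ν) (suc c) e
      extended = begin
        levelSeries (P ∘ (part L ∷_)) (suc L)
          ≈⟨ levelSeries-cong (suc L) (λ {μ} _ → cong (isM a m ν) (sym (Listₚ.++-assoc pre [ part L ] μ))) ⟩
        levelSeries (λ μ → isM a m ν (pre⁺ ++ μ)) (suc L)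
          ≡⟨ cong (levelSeries (λ μ → isM a m ν (pre⁺ ++ μ))) level⁺ ⟨
        levelSeries (λ μ → isM a m ν (pre⁺ ++ μ)) (suc (suc ν) + length pre⁺ + e)
          ≈⟨ isM-series e pre⁺ hs⁺ ⟩
        X t ⊛ durfee (suc ν) (length pre⁺) e
          ≡⟨ cong (λ k → X t ⊛ durfee (suc ν) k e) length⁺ ⟩
        X t ⊛ durfee (suc ν) (suc c) e ∎

-- The recurrence in ν

partitionSeries : Series
partitionSeries n = + p n

genSeries-all : ∀ {m n} → n ≤ m → genSeries (λ _ → true) m n ≡ partitionSeries n
genSeries-all {m} {n} n≤m = trans (genSeries-stable (λ _ → true) ℕₚ.≤-refl n≤m)
  (cong (λ xs → + length xs) (Listₚ.filter-all (λ _ → true Bool.≟ true) (All.universal (λ _ → refl) (partsUpTo n n n))))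

module Recurrence (a′ m′ : ℕ) where

  open Durfee a′ m′ public

  n≤bound : ∀ {n L} → n ≤ L → n ≤ a′ + m * L
  n≤bound {n} {L} n≤L = ℕₚ.≤-trans n≤L (ℕₚ.≤-trans (ℕₚ.m≤m+n L (m′ * L)) (ℕₚ.m≤n+m (m * L) a′))

  -- Bounding the other parts by `n` instead of by the level gives ν and ν + 1, whose levels differ,
  -- a common factor.
  factor-limit : ∀ P {n i L} → i ≤ n → n ≤ L → genSeries (P ∘ selected) (a′ + m * L) i ≡ (otherSeries n ⊛ levelSeries P L) i
  factor-limit P {n} {i} {L} i≤n n≤L = trans (coeff (factor P (a′ + m * L)) i)
    (⊛-cong-≤ i (λ j j≤i → genSeries-stable _ (ℕₚ.≤-trans j≤i i≤n) (n≤bound n≤L)) (λ _ _ → refl))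

  pM-series : ∀ ν n → + pM a m ν n ≡ (otherSeries n ⊛ (X (partSum (suc ν)) ⊛ durfee (suc ν) 0 n)) n
  pM-series ν n = begin
    genSeries (isM a m ν ∘ selected) n n
      ≡⟨ genSeries-stable (isM a m ν ∘ selected) ℕₚ.≤-refl (n≤bound n≤L) ⟨
    genSeries (isM a m ν ∘ selected) (a′ + m * L) n
      ≡⟨ factor-limit (isM a m ν) ℕₚ.≤-refl n≤L ⟩
    (otherSeries n ⊛ levelSeries (isM a m ν) L) n
      ≡⟨ coeff (⊛-congˡ (isM-series ν n [] [])) n ⟩
    (otherSeries n ⊛ (X (partSum (suc ν)) ⊛ durfee (suc ν) 0 n)) n ∎
    where
    open ≡-Reasoning
    -- With nothing chosen and e = n the level is at least `n`, so its bound on the parts excludes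
    -- no partition of `n`.
    L = suc (suc ν) + 0 + n
    n≤L : n ≤ L
    n≤L = ℕₚ.m≤n+m n (suc (suc ν) + 0)

  -- The additional required part of `suc ν`, namely `part (suc ν)`, is exactly the offset in
  -- `durfee-complement` at c = 0.
  pM-recurrence : ∀ ν n → + pM a m ν n +ℤ + pM a m (suc ν) n ≡ shift (partSum (suc ν)) partitionSeries n
  pM-recurrence ν n = begin
    + pM a m ν n +ℤ + pM a m (suc ν) n
      ≡⟨ cong₂ _+ℤ_ (pM-series ν n) (pM-series (suc ν) n) ⟩
    (o ⊛ (X t ⊛ d)) n +ℤ (o ⊛ (X (part (suc ν) + t) ⊛ d′)) n
      ≡⟨ ⊕-coeff (o ⊛ (X t ⊛ d)) (o ⊛ (X (part (suc ν) + t) ⊛ d′)) n ⟨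
    (o ⊛ (X t ⊛ d) ⊕ o ⊛ (X (part (suc ν) + t) ⊛ d′)) n
      ≡⟨ coeff combine n ⟩
    shift t (o ⊛ small L) n
      ≡⟨ shift-cong-≤ t n unrestricted ⟩
    shift t partitionSeries n ∎
    where
    open ≡-Reasoning
    o = otherSeries n
    t = partSum (suc ν)
    d = durfee (suc ν) 0 n
    d′ = durfee (suc (suc ν)) 0 n
    L = suc (suc ν) + 0 + n
    combine : o ⊛ (X t ⊛ d) ⊕ o ⊛ (X (part (suc ν) + t) ⊛ d′) ≈ shift t (o ⊛ small L)
    combine = E.begin
      o ⊛ (X t ⊛ d) ⊕ o ⊛ (X (part (suc ν) + t) ⊛ d′)
        E.≈⟨ ⊕-congˡ (⊛-congˡ (⊛-congʳ (X-+ (part (suc ν)) t))) ⟩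
      o ⊛ (X t ⊛ d) ⊕ o ⊛ (X (part (suc ν)) ⊛ X t ⊛ d′)
        E.≈⟨ solve 5 (λ o t d x d′ → o :* (t :* d) :+ o :* (x :* t :* d′) := t :* (o :* (d :+ x :* d′)))
             ≈-refl o (X t) d (X (part (suc ν))) d′ ⟩
      X t ⊛ (o ⊛ (d ⊕ X (part (suc ν)) ⊛ d′))
        E.≡⟨ cong (λ k → X t ⊛ (o ⊛ (d ⊕ X k ⊛ d′))) (trans (cong (λ k → part (suc ν) + k) (ℕₚ.*-zeroʳ m)) (ℕₚ.+-identityʳ _)) ⟨
      X t ⊛ (o ⊛ (d ⊕ X (part (suc ν) + m * 0) ⊛ d′))
        E.≈⟨ ⊛-congˡ (⊛-congˡ (durfee-complement (suc ν) 0 n)) ⟩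
      X t ⊛ (o ⊛ small L)
        E.≈⟨ X-⊛ t (o ⊛ small L) ⟩
      shift t (o ⊛ small L) E.∎
      where module E = ≈-Reasoning
    n≤L : n ≤ L
    n≤L = ℕₚ.m≤n+m n (suc (suc ν) + 0)
    unrestricted : ∀ i → i ≤ n → (o ⊛ small L) i ≡ partitionSeries i
    unrestricted i i≤n = trans (sym (factor-limit (λ _ → true) i≤n n≤L)) (genSeries-all (ℕₚ.≤-trans i≤n (n≤bound n≤L)))

-- The parts 1, 5, 9, ... and 3, 7, 11, ...

module One = Recurrence 0 3
module Three = Recurrence 2 3

partSum-1 : ∀ k → One.partSum (suc k) ≡ (k + 1) * (2 * k + 1)
partSum-1 zero    = refl
partSum-1 (suc k) = trans (cong (λ s → One.part (suc k) + s) (partSum-1 k)) (step k)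
  where
  step : ∀ k → 1 + 4 * suc k + (k + 1) * (2 * k + 1) ≡ (suc k + 1) * (2 * suc k + 1)
  step = solve-∀

partSum-3 : ∀ k → Three.partSum k ≡ k * (2 * k + 1)
partSum-3 zero    = refl
partSum-3 (suc k) = trans (cong (λ s → Three.part k + s) (partSum-3 k)) (step k)
  where
  step : ∀ k → 3 + 4 * k + k * (2 * k + 1) ≡ suc k * (2 * suc k + 1)
  step = solve-∀

-- Odd parts and the substitution of q² for q

-- The series f(q²). Partitions into the parts 2, 6, 10, ... are partitions into odd parts with
-- every part doubled, which brings p_o into Gauss's product.
dilate : Series → Series
dilate f zero          = f 0
dilate f (suc zero)    = 0ℤ
dilate f (suc (suc n)) = dilate (f ∘ suc) n

dilate-congₙ : ∀ {f g} → (∀ n → f n ≡ g n) → ∀ n → dilate f n ≡ dilate g n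
dilate-congₙ eq zero          = eq 0
dilate-congₙ eq (suc zero)    = refl
dilate-congₙ eq (suc (suc n)) = dilate-congₙ (eq ∘ suc) n

dilate-⊕ : ∀ f g → dilate (f ⊕ g) ≈ dilate f ⊕ dilate g
dilate-⊕ f g = coeffs λ n → trans (dilate-congₙ (⊕-coeff f g) n) (trans (go f g n) (sym (⊕-coeff (dilate f) (dilate g) n)))
  where
  go : ∀ f g n → dilate (λ i → f i +ℤ g i) n ≡ dilate f n +ℤ dilate g n
  go f g zero          = refl
  go f g (suc zero)    = refl
  go f g (suc (suc n)) = go (f ∘ suc) (g ∘ suc) n

dilate-shift : ∀ k f n → dilate (shift k f) n ≡ shift (2 * k) (dilate f) n
dilate-shift zero    f n = refl
dilate-shift (suc k) f n = trans (go n) (cong (λ j → shift j (dilate f) n) (sym (twice k)))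
  where
  twice : ∀ k → 2 * suc k ≡ suc (suc (2 * k))
  twice = solve-∀
  go : ∀ n → dilate (shift (suc k) f) n ≡ shift (suc (suc (2 * k))) (dilate f) n
  go zero          = refl
  go (suc zero)    = refl
  go (suc (suc n)) = dilate-shift k f n

dilate-𝟙 : dilate 𝟙 ≈ 𝟙
dilate-𝟙 = coeffs go
  where
  zeros : ∀ n → dilate (λ _ → 0ℤ) n ≡ 0ℤ
  zeros zero          = refl
  zeros (suc zero)    = refl
  zeros (suc (suc n)) = zeros n
  go : ∀ n → dilate 𝟙 n ≡ 𝟙 n
  go zero          = refl
  go (suc zero)    = refl
  go (suc (suc n)) = zeros n

dilate-even : ∀ f n → dilate f (2 * n) ≡ f n
dilate-even f n = trans (cong (dilate f) (double n)) (go f n)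
  where
  double : ∀ n → 2 * n ≡ n * 2
  double = solve-∀
  go : ∀ f n → dilate f (n * 2) ≡ f n
  go f zero    = refl
  go f (suc n) = go (f ∘ suc) n

dilate-odd : ∀ f n → dilate f (2 * n + 1) ≡ 0ℤ
dilate-odd f n = trans (cong (dilate f) (double n)) (go f n)
  where
  double : ∀ n → 2 * n + 1 ≡ suc (n * 2)
  double = solve-∀
  go : ∀ f n → dilate f (suc (n * 2)) ≡ 0ℤ
  go f zero    = refl
  go f (suc n) = go (f ∘ suc) n

oddSeries : ℕ → Series
oddSeries N = genSeries (all isOdd) (2 * N)

isOdd-odd : ∀ N → isOdd (suc (2 * N)) ≡ true
isOdd-odd N = ⌊⌋-true (suc (2 * N) % 2 ≟ 1) (trans (cong (λ k → suc k % 2) (ℕₚ.*-comm 2 N)) ([m+kn]%n≡m%n 1 N 2))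

isOdd-even : ∀ N → isOdd (suc (suc (2 * N))) ≡ false
isOdd-even N = ⌊⌋-false (suc (suc (2 * N)) % 2 ≟ 1) λ eq → 0≢1 (trans (sym (trans (cong (λ k → suc (suc k) % 2) (ℕₚ.*-comm 2 N)) ([m+kn]%n≡m%n 0 (suc N) 2))) eq)
  where
  0≢1 : 0 ≢ 1
  0≢1 ()

oddSeries-suc : ∀ N → oddSeries (suc N) ≈ oddSeries N ⊕ shift (1 + 2 * N) (oddSeries (suc N))
oddSeries-suc N = begin
  oddSeries (suc N)
    ≈⟨ skip ⟩
  genSeries (all isOdd) (1 + 2 * N)
    ≈⟨ genSeries-suc′ (all isOdd) (2 * N) (λ μ → cong (_∧ all isOdd μ) (isOdd-odd N)) ⟩
  oddSeries N ⊕ X (1 + 2 * N) ⊛ genSeries (all isOdd) (1 + 2 * N)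
    ≈⟨ ⊕-congˡ (≈-trans (X-⊛ (1 + 2 * N) _) (shift-cong (1 + 2 * N) (≈-sym skip))) ⟩
  oddSeries N ⊕ shift (1 + 2 * N) (oddSeries (suc N)) ∎
  where
  open ≈-Reasoning
  next : ∀ N → 2 * suc N ≡ suc (1 + 2 * N)
  next = solve-∀
  skip : oddSeries (suc N) ≈ genSeries (all isOdd) (1 + 2 * N)
  skip = ≈-trans (≡⇒≈ (cong (genSeries (all isOdd)) (next N)))
    (genSeries-skip (all isOdd) (1 + 2 * N) λ μ → cong (_∧ all isOdd μ) (isOdd-even N))

dilate-cong : ∀ {f g} → f ≈ g → dilate f ≈ dilate g
dilate-cong eq = coeffs (dilate-congₙ (coeff eq))

open Gauss (genSeries (λ _ → true)) (dilate ∘ oddSeries)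
  (genSeries-0 (λ _ → true))
  (genSeries-suc (λ _ → true))
  (≈-trans (dilate-cong (genSeries-0 (all isOdd))) dilate-𝟙)
  (λ N → ≈-trans (dilate-cong (oddSeries-suc N)) (≈-trans (dilate-⊕ (oddSeries N) (shift (1 + 2 * N) (oddSeries (suc N))))
    (⊕-congˡ (≈-trans (coeffs (dilate-shift (1 + 2 * N) (oddSeries (suc N)))) (≈-sym (X-⊛ (2 * (1 + 2 * N)) (dilate (oddSeries (suc N)))))))))

-- Telescoping in ν and comparison of coefficients

sumBelow-suc : ∀ N f → sumBelow (suc N) f ≡ sumBelow N f +ℤ f N
sumBelow-suc N f = trans (cong (foldr _+ℤ_ 0ℤ ∘ map f) (sym (Listₚ.upTo-∷ʳ N)))
  (trans (cong (foldr _+ℤ_ 0ℤ) (Listₚ.map-++ f (upTo N) [ N ])) (go (map f (upTo N))))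
  where
  go : ∀ xs → foldr _+ℤ_ 0ℤ (xs ++ [ f N ]) ≡ foldr _+ℤ_ 0ℤ xs +ℤ f N
  go []       = trans (ℤₚ.+-identityʳ (f N)) (sym (ℤₚ.+-identityˡ (f N)))
  go (x ∷ xs) = trans (cong (x +ℤ_) (go xs)) (sym (ℤₚ.+-assoc x _ (f N)))

sumBelow-cong : ∀ N {f g} → (∀ τ → τ < N → f τ ≡ g τ) → sumBelow N f ≡ sumBelow N g
sumBelow-cong zero    eq = refl
sumBelow-cong (suc N) {f} {g} eq = trans (sumBelow-suc N f)
  (trans (cong₂ _+ℤ_ (sumBelow-cong N λ τ τ<N → eq τ (ℕₚ.m≤n⇒m≤1+n τ<N)) (eq N ℕₚ.≤-refl)) (sym (sumBelow-suc N g)))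

alternating : ℕ → (ℕ → ℤ) → ℤ
alternating N f = sumBelow N (λ τ → -1ℤ ^ τ *ℤ f τ)

alternating-suc : ∀ N f → alternating (suc N) f ≡ alternating N f +ℤ -1ℤ ^ N *ℤ f N
alternating-suc N f = sumBelow-suc N (λ τ → -1ℤ ^ τ *ℤ f τ)

module Telescope (f g x y : ℕ → ℤ) (x-rec : ∀ ν → x ν +ℤ x (suc ν) ≡ g ν) (y-rec : ∀ ν → y ν +ℤ y (suc ν) ≡ f (suc ν)) where

  defect : ℕ → ℤ
  defect ν = alternating (suc ν) f -ℤ alternating ν g -ℤ -1ℤ ^ ν *ℤ (y ν +ℤ x ν)

  -- The new terms are `y ν + y (suc ν)` and `x ν + x (suc ν)`. With their signs, the halves at
  -- `suc ν` cancel against the new correction and the halves at `ν` restore the old one.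
  defect-suc : ∀ ν → defect (suc ν) ≡ defect ν
  defect-suc ν = begin
    alternating (suc (suc ν)) f -ℤ alternating (suc ν) g -ℤ -1ℤ *ℤ s *ℤ (y (suc ν) +ℤ x (suc ν))
      ≡⟨ cong₂ (λ u v → u -ℤ v -ℤ -1ℤ *ℤ s *ℤ (y (suc ν) +ℤ x (suc ν)))
           (trans (alternating-suc (suc ν) f) (cong (λ z → F +ℤ -1ℤ *ℤ s *ℤ z) (sym (y-rec ν))))
           (trans (alternating-suc ν g) (cong (λ z → G +ℤ s *ℤ z) (sym (x-rec ν)))) ⟩
    F +ℤ -1ℤ *ℤ s *ℤ (y ν +ℤ y (suc ν)) -ℤ (G +ℤ s *ℤ (x ν +ℤ x (suc ν))) -ℤ -1ℤ *ℤ s *ℤ (y (suc ν) +ℤ x (suc ν))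
      ≡⟨ cancel F G s (y ν) (y (suc ν)) (x ν) (x (suc ν)) ⟩
    F -ℤ G -ℤ s *ℤ (y ν +ℤ x ν) ∎
    where
    open ≡-Reasoning
    s = -1ℤ ^ ν
    F = alternating (suc ν) f
    G = alternating ν g
    cancel : ∀ F G s y y′ x x′ → F +ℤ -1ℤ *ℤ s *ℤ (y +ℤ y′) -ℤ (G +ℤ s *ℤ (x +ℤ x′)) -ℤ -1ℤ *ℤ s *ℤ (y′ +ℤ x′) ≡ F -ℤ G -ℤ s *ℤ (y +ℤ x)
    cancel = ℤSolver.solve-∀

  defect-const : ∀ ν → defect ν ≡ defect 0
  defect-const zero    = refl
  defect-const (suc ν) = trans (defect-suc ν) (defect-const ν)

-1^ν-square : ∀ ν → -1ℤ ^ ν *ℤ -1ℤ ^ ν ≡ 1ℤ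
-1^ν-square ν = trans (sym (ℤₚ.^-distribˡ-+-* -1ℤ ν ν)) (trans (cong (λ k → -1ℤ ^ (ν + k)) (sym (ℕₚ.+-identityʳ ν))) (-1^even ν))

-- The recurrence controls only sums of consecutive counts; as counts are nonnegative, a vanishing
-- sum still kills each of them.
sum≡0 : ∀ i j → + i +ℤ + j ≡ 0ℤ → + i ≡ 0ℤ
sum≡0 i j eq = cong +_ (ℕₚ.m+n≡0⇒m≡0 i (ℤₚ.+-injective eq))

module Coefficient (n : ℕ) where

  -- `shift` gives 0 at a negative argument, where truncated subtraction would give p(0) = 1. This
  -- lets the telescoping run through all ν.
  f g x y : ℕ → ℤ
  f τ = shift (τ * (2 * τ + 1)) partitionSeries n
  g τ = shift ((τ + 1) * (2 * τ + 1)) partitionSeries n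
  x ν = + pM 1 4 ν n
  y ν = + pM 3 4 ν n

  x-rec : ∀ ν → x ν +ℤ x (suc ν) ≡ g ν
  x-rec ν = trans (One.pM-recurrence ν n) (cong (λ k → shift k partitionSeries n) (partSum-1 ν))

  y-rec : ∀ ν → y ν +ℤ y (suc ν) ≡ f (suc ν)
  y-rec ν = trans (Three.pM-recurrence ν n) (cong (λ k → shift k partitionSeries n) (partSum-3 (suc ν)))

  open Telescope f g x y x-rec y-rec

  Y-⊛-coeff : ∀ k s (h : Series) → -1ℤ ^ k ≡ s → (∀ i → i ≤ n → h i ≡ partitionSeries i) → (Y k ⊛ h) n ≡ s *ℤ shift k partitionSeries n
  Y-⊛-coeff k s h refl eq = trans (coeff (≈-trans (⊛-assoc (const (-1ℤ ^ k)) (X k) h) (⊛-congˡ (X-⊛ k h))) n)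
    (trans (const-⊛ₙ (-1ℤ ^ k) (shift k h) n) (cong (-1ℤ ^ k *ℤ_) (shift-cong-≤ k n eq)))

  triangularSum-coeff : ∀ N h → (∀ i → i ≤ n → h i ≡ partitionSeries i) → (triangularSum N ⊛ h) n ≡ alternating N f -ℤ alternating N g
  triangularSum-coeff zero    h eq = trans (const-⊛ₙ 0ℤ h n) (ℤₚ.*-zeroˡ (h n))
  triangularSum-coeff (suc N) h eq = begin
    ((θ ⊕ (Y u ⊕ Y v)) ⊛ h) n
      ≡⟨ coeff (solve 4 (λ θ a b h → (θ :+ (a :+ b)) :* h := θ :* h :+ (a :* h :+ b :* h))
           ≈-refl θ (Y u) (Y v) h) n ⟩
    (θ ⊛ h ⊕ (Y u ⊛ h ⊕ Y v ⊛ h)) n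
      ≡⟨ trans (⊕-coeff _ _ n) (cong ((θ ⊛ h) n +ℤ_) (⊕-coeff _ _ n)) ⟩
    (θ ⊛ h) n +ℤ ((Y u ⊛ h) n +ℤ (Y v ⊛ h) n)
      -- The exponents N(2N+1) and (N+1)(2N+1) have the parities of N and N+1; this is the source of
      -- the alternating signs and of the minus between the two sums.
      ≡⟨ cong₂ _+ℤ_ (triangularSum-coeff N h eq) (cong₂ _+ℤ_
           (Y-⊛-coeff u (-1ℤ ^ N) h (trans (cong (-1ℤ ^_) (parity-u N)) (-1^[k+2l] N (N * N))) eq)
           (Y-⊛-coeff v (-1ℤ *ℤ -1ℤ ^ N) h (trans (cong (-1ℤ ^_) (parity-v N)) (-1^[k+2l] (suc N) (N * N + N))) eq)) ⟩
    F -ℤ G +ℤ (-1ℤ ^ N *ℤ f N +ℤ -1ℤ *ℤ -1ℤ ^ N *ℤ g N)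
      ≡⟨ regroup F G (-1ℤ ^ N) (f N) (g N) ⟩
    (F +ℤ -1ℤ ^ N *ℤ f N) -ℤ (G +ℤ -1ℤ ^ N *ℤ g N)
      ≡⟨ cong₂ _-ℤ_ (alternating-suc N f) (alternating-suc N g) ⟨
    alternating (suc N) f -ℤ alternating (suc N) g ∎
    where
    open ≡-Reasoning
    θ = triangularSum N
    u = N * (2 * N + 1)
    v = (N + 1) * (2 * N + 1)
    F = alternating N f
    G = alternating N g
    parity-u : ∀ N → N * (2 * N + 1) ≡ N + 2 * (N * N)
    parity-u = solve-∀
    parity-v : ∀ N → (N + 1) * (2 * N + 1) ≡ suc N + 2 * (N * N + N)
    parity-v = solve-∀
    regroup : ∀ F G s a b → F -ℤ G +ℤ (s *ℤ a +ℤ -1ℤ *ℤ s *ℤ b) ≡ (F +ℤ s *ℤ a) -ℤ (G +ℤ s *ℤ b)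
    regroup = ℤSolver.solve-∀

  -- Large enough for three purposes: the exponents from K(2K+1) on exceed `n`, the parts of
  -- partitions of i ≤ n are at most 2K, and the remainder in `gauss` begins beyond `n`, at 2K+1.
  K : ℕ
  K = suc n

  n<u : ∀ k → n < k → n < k * (2 * k + 1)
  n<u k n<k = ℕₚ.<-≤-trans n<k (ℕₚ.≤-trans (ℕₚ.≤-reflexive (sym (ℕₚ.*-identityʳ k))) (ℕₚ.*-monoʳ-≤ k (ℕₚ.m≤n+m 1 (2 * k))))

  n<v : ∀ k → n < k → n < (k + 1) * (2 * k + 1)
  n<v k n<k = ℕₚ.<-≤-trans (n<u k n<k) (ℕₚ.*-monoˡ-≤ (2 * k + 1) (ℕₚ.m≤m+n k 1))

  defect-K : defect K ≡ dilate (oddSeries K) n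
  defect-K = begin
    alternating (suc K) f -ℤ alternating K g -ℤ -1ℤ ^ K *ℤ (y K +ℤ x K)
      ≡⟨ cong₂ (λ u v → u -ℤ alternating K g -ℤ -1ℤ ^ K *ℤ v)
           (trans (alternating-suc K f) (cong (λ z → alternating K f +ℤ -1ℤ ^ K *ℤ z) (shift-< partitionSeries (n<u K ℕₚ.≤-refl))))
           (cong₂ _+ℤ_ (sum≡0 (pM 3 4 K n) (pM 3 4 (suc K) n) (trans (y-rec K) (shift-< partitionSeries (n<u (suc K) (ℕₚ.n≤1+n K)))))
                       (sum≡0 (pM 1 4 K n) (pM 1 4 (suc K) n) (trans (x-rec K) (shift-< partitionSeries (n<v K ℕₚ.≤-refl))))) ⟩
    (alternating K f +ℤ -1ℤ ^ K *ℤ 0ℤ) -ℤ alternating K g -ℤ -1ℤ ^ K *ℤ (0ℤ +ℤ 0ℤ)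
      ≡⟨ vanish (alternating K f) (alternating K g) (-1ℤ ^ K) ⟩
    alternating K f -ℤ alternating K g
      ≡⟨ triangularSum-coeff K (genSeries (λ _ → true) (2 * K)) (λ i i≤n → genSeries-all (ℕₚ.≤-trans i≤n n≤2K)) ⟨
    (triangularSum K ⊛ genSeries (λ _ → true) (2 * K)) n
      ≡⟨ gauss n n (ℕₚ.≤-<-trans n≤2K (ℕₚ.m<m+n (2 * K) (s≤s z≤n))) ⟩
    dilate (oddSeries K) n ∎
    where
    open ≡-Reasoning
    vanish : ∀ F G s → (F +ℤ s *ℤ 0ℤ) -ℤ G -ℤ s *ℤ (0ℤ +ℤ 0ℤ) ≡ F -ℤ G
    vanish = ℤSolver.solve-∀
    n≤2K : n ≤ 2 * K
    n≤2K = ℕₚ.≤-trans (ℕₚ.n≤1+n n) (ℕₚ.m≤m+n K (K + 0))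

  truncated : ∀ ν → -1ℤ ^ ν *ℤ (alternating (suc ν) f -ℤ alternating ν g) ≡ -1ℤ ^ ν *ℤ dilate (oddSeries K) n +ℤ y ν +ℤ x ν
  truncated ν = begin
    s *ℤ (F -ℤ G)                                      ≡⟨ split s (F -ℤ G) (y ν) (x ν) ⟩
    -- ν may lie on either side of `K`, so both defects are compared with the one at 0.
    s *ℤ defect ν +ℤ s *ℤ s *ℤ (y ν +ℤ x ν)            ≡⟨ cong₂ (λ d e → s *ℤ d +ℤ e *ℤ (y ν +ℤ x ν))
                                                            (trans (defect-const ν) (trans (sym (defect-const K)) defect-K)) (-1^ν-square ν) ⟩
    s *ℤ δ +ℤ 1ℤ *ℤ (y ν +ℤ x ν)                       ≡⟨ cong (s *ℤ δ +ℤ_) (ℤₚ.*-identityˡ (y ν +ℤ x ν)) ⟩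
    s *ℤ δ +ℤ (y ν +ℤ x ν)                             ≡⟨ ℤₚ.+-assoc (s *ℤ δ) (y ν) (x ν) ⟨
    s *ℤ δ +ℤ y ν +ℤ x ν ∎
    where
    open ≡-Reasoning
    s = -1ℤ ^ ν
    F = alternating (suc ν) f
    G = alternating ν g
    δ = dilate (oddSeries K) n
    split : ∀ s d y x → s *ℤ d ≡ s *ℤ (d -ℤ s *ℤ (y +ℤ x)) +ℤ s *ℤ s *ℤ (y +ℤ x)
    split = ℤSolver.solve-∀

  -- The bound on ν ensures that no subtraction in the arguments of p is truncated.
  truncated-p : ∀ ν → ν * (2 * ν + 3) ≤ n →
    -1ℤ ^ ν *ℤ (sumBelow (suc ν) (λ τ → -1ℤ ^ τ *ℤ + p (n ∸ τ * (2 * τ + 1)))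
                -ℤ sumBelow ν (λ τ → -1ℤ ^ τ *ℤ + p (n ∸ (τ + 1) * (2 * τ + 1))))
    ≡ -1ℤ ^ ν *ℤ dilate (oddSeries K) n +ℤ y ν +ℤ x ν
  truncated-p ν small-ν = trans (cong₂ (λ F G → -1ℤ ^ ν *ℤ (F -ℤ G))
    (sumBelow-cong (suc ν) λ τ τ≤ν → cong (-1ℤ ^ τ *ℤ_) (sym (shift-≥ partitionSeries (ℕₚ.≤-trans (u≤ τ (ℕₚ.≤-pred τ≤ν)) small-ν))))
    (sumBelow-cong ν λ τ τ<ν → cong (-1ℤ ^ τ *ℤ_) (sym (shift-≥ partitionSeries (ℕₚ.≤-trans (v≤ τ τ<ν) small-ν)))))
    (truncated ν)
    where
    odd≤ : ∀ {τ} → τ ≤ ν → 2 * τ + 1 ≤ 2 * ν + 3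
    odd≤ τ≤ν = ℕₚ.+-mono-≤ (ℕₚ.*-monoʳ-≤ 2 τ≤ν) (s≤s z≤n)
    u≤ : ∀ τ → τ ≤ ν → τ * (2 * τ + 1) ≤ ν * (2 * ν + 3)
    u≤ τ τ≤ν = ℕₚ.*-mono-≤ τ≤ν (odd≤ τ≤ν)
    v≤ : ∀ τ → τ < ν → (τ + 1) * (2 * τ + 1) ≤ ν * (2 * ν + 3)
    v≤ τ τ<ν = ℕₚ.*-mono-≤ (subst (_≤ ν) (ℕₚ.+-comm 1 τ) τ<ν) (odd≤ (ℕₚ.<⇒≤ τ<ν))

theorem1p4 : (ν n : ℕ) → 1 ≤ ν → ν * (2 * ν + 3) < n →
    (-1ℤ ^ ν *ℤ (sumBelow (suc ν) (λ τ → -1ℤ ^ τ *ℤ + p (2 * n ∸ τ * (2 * τ + 1)))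
    -ℤ sumBelow ν (λ τ → -1ℤ ^ τ *ℤ + p (2 * n ∸ (τ + 1) * (2 * τ + 1))))
    ≡ -1ℤ ^ ν *ℤ + pₒ n +ℤ + pM 3 4 ν (2 * n) +ℤ + pM 1 4 ν (2 * n))
    × (-1ℤ ^ ν *ℤ (sumBelow (suc ν) (λ τ → -1ℤ ^ τ *ℤ + p (2 * n + 1 ∸ τ * (2 * τ + 1)))
    -ℤ sumBelow ν (λ τ → -1ℤ ^ τ *ℤ + p (2 * n + 1 ∸ (τ + 1) * (2 * τ + 1))))
    ≡ + pM 3 4 ν (2 * n + 1) +ℤ + pM 1 4 ν (2 * n + 1))
theorem1p4 ν n _ ν<n = even , odd
  where
  n≤2n : n ≤ 2 * n
  n≤2n = ℕₚ.m≤m+n n (n + 0)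
  -- The even coefficient of the dilated series is one of `oddSeries`, whose bound on the parts
  -- exceeds `n`, hence p_o(n).
  even = trans (Coefficient.truncated-p (2 * n) ν (ℕₚ.≤-trans (ℕₚ.<⇒≤ ν<n) n≤2n))
    (cong (λ z → -1ℤ ^ ν *ℤ z +ℤ + pM 3 4 ν (2 * n) +ℤ + pM 1 4 ν (2 * n))
      (trans (dilate-even (oddSeries (suc (2 * n))) n)
        (genSeries-stable (all isOdd) ℕₚ.≤-refl (ℕₚ.≤-trans n≤2n (ℕₚ.*-monoʳ-≤ 2 (ℕₚ.≤-trans n≤2n (ℕₚ.n≤1+n (2 * n))))))))
  odd = trans (Coefficient.truncated-p (2 * n + 1) ν (ℕₚ.≤-trans (ℕₚ.<⇒≤ ν<n) (ℕₚ.≤-trans n≤2n (ℕₚ.m≤m+n (2 * n) 1))))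
    (cong (λ z → z +ℤ + pM 3 4 ν (2 * n + 1) +ℤ + pM 1 4 ν (2 * n + 1))
      (trans (cong (-1ℤ ^ ν *ℤ_) (dilate-odd (oddSeries (suc (2 * n + 1))) n)) (ℤₚ.*-zeroʳ (-1ℤ ^ ν))))
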